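{- Let $\mathbb{X}(\mathcal{T})$ be the group of characters of the Hopf algebra $\mathcal{T}$, under convolution. (1) For every $g\in\widetilde{\mathcal{G}}$ there exists a character $\chi_g\in\mathbb{X}(\mathcal{T})$, uniquely determined, such that $\chi_g(X_\pi)=g(\pi,1_n)$ for all $n\ge1$ and $\pi\in NC(n)$. (2) The map $\widetilde{\mathcal{G}}\ni g\mapsto\chi_g\in\mathbb{X}(\mathcal{T})$ is a group isomorphism, i.e. it is bijective and has $\chi_{g_1*g_2}=\chi_{g_1}*\chi_{g_2}$ for all $g_1,g_2\in\widetilde{\mathcal{G}}$.
   Context: For $n \ge 1$, $NC(n)$ is the set of non-crossing partitions of $\{1,\ldots,n\}$, partially ordered by reverse refinement: $\pi \le \sigma$ iff every block of $\sigma$ is a union of blocks of $\pi$. $1_n \in NC(n)$ is the partition with a single block. Put $NC^{(2)} := \sqcup_{n=1}^{\infty} \{ (\pi,\sigma) \mid \pi,\sigma \in NC(n),\ \pi \le \sigma \}$. For $\pi \in NC(n)$ and a non-empty $W = \{p_1 < \cdots < p_m\} \subseteq \{1,\ldots,n\}$, $\pi_W \in NC(m)$ is the partition for which $i,j$ are in the same block of $\pi_W$ iff $p_i,p_j$ are in the same block of $\pi$. $\widetilde{\mathcal{G}}$ is the set of functions $g : NC^{(2)} \to \mathbb{C}$ such that $g(\pi,\pi)=1$ for all $\pi$ and $g(\pi,\sigma) = \prod_{W \in \sigma} g(\pi_W, 1_{|W|})$ for every $n \ge 1$ and $\pi \le \sigma$ in $NC(n)$. It is a group under convolution, $(f*g)(\pi,\sigma)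 = \sum_{\rho:\ \pi \le \rho \le \sigma} f(\pi,\rho) g(\rho,\sigma)$. $\mathcal{T}=\mathbb{C}\bigl[X_\pi\mid\pi\in\sqcup_{n=1}^\infty(NC(n)\setminus\{1_n\})\bigr]$ is the commutative polynomial algebra, with the convention $X_{1_n}:=1_{\mathcal{T}}$. It is a Hopf algebra with comultiplication the unital algebra homomorphism $\Delta:\mathcal{T}\to\mathcal{T}\otimes\mathcal{T}$ determined by $\Delta(X_\pi)=\sum_{\sigma\in NC(n),\ \sigma\ge\pi}\bigl(\prod_{W\in\sigma}X_{\pi_W}\bigr)\otimes X_\sigma$ ($n\ge 1$, $\pi \in NC(n)$), and with counit the unital algebra homomorphism $\epsilon:\mathcal{T}\to\mathbb{C}$ determined by $\epsilon(X_\pi)=0$ for $\pi\in\sqcup_n(NC(n)\setminus\{1_n\})$. $\mathbb{X}(\mathcal{T})$ is the set of characters (unital algebra homomorphisms $\mathcal{T}\to\mathbb{C}$); it is a group under the convolution $\chi_1*\chi_2=(\chi_1\otimes\chi_2)\circ\Delta$ (with $\mathbb{C}\otimes\mathbb{C}$ identified with $\mathbb{C}$). -}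

module Defs where

open import Level using (Level; _⊔_; suc)
open import Algebra.Bundles using (CommutativeMonoid; CommutativeRing; AbelianGroup; RawMagma)
open import Algebra.Morphism.Structures using (IsRingHomomorphism)
import Algebra.Properties.CommutativeMonoid.Sum as FinSum
import Algebra.Properties.AbelianGroup as AbelianGroupProperties
import Algebra.Properties.CommutativeSemigroup as CommutativeSemigroupProperties
import Algebra.Properties.Ring as RingProperties
import Relation.Binary.Reasoning.Setoid as SetoidReasoning
open import Data.Bool using (true; false)
import Data.Bool as Bool
open import Data.Fin as Fin using (Fin; _≤_; _<_)
import Data.Fin.Properties as Fin
open import Data.Fin.Subset using (Subset; inside; outside; _∈_; _⊆_; ∣_∣)
open import Data.Fin.Subset.Properties using (_∈?_; _⊆?_; ⊆-antisym)
open import Data.List using (List; []; _∷_; foldr; map; mapMaybe; _++_; cartesianProductWith)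
open import Data.Maybe using (Maybe; just; nothing; maybe)
open import Data.Nat as ℕ using (ℕ; NonZero; z≤n; s≤s)
import Data.Nat.Properties as ℕ
open import Data.Product using (Σ; ∃; ∃!; _×_; _,_; proj₁; proj₂)
open import Data.Vec using (Vec; []; _∷_; lookup; tabulate; here; there)
import Data.Vec.Properties as Vec
open import Data.Unit using (⊤; tt)
open import Function using (_∘_; id)
open import Relation.Binary.PropositionalEquality as ≡ using (_≡_; _≢_)
open import Relation.Binary.Structures using (IsEquivalence)
open import Relation.Nullary
  using (Dec; yes; no; does; ¬_; recompute; _×-dec_; _→-dec_; contradiction; contradiction-irr)
open import Relation.Nullary.Decidable using (map′; dec-true)

private
  variable
    m n : ℕ

------------------------------------------------------------------------
-- Non-crossing partitions

-- A partition of Fin n is stored as the vector whose i-th entry is the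
-- block containing i.

IsPartition : Vec (Subset n) n → Set
IsPartition B =
  (∀ i → i ∈ lookup B i) × (∀ i j → j ∈ lookup B i → lookup B j ≡ lookup B i)

NonCrossing : Vec (Subset n) n → Set
NonCrossing B = ∀ a b c d → a < b → b < c → c < d →
  c ∈ lookup B a → d ∈ lookup B b → b ∈ lookup B a

_≟ˢ_ : (V W : Subset n) → Dec (V ≡ W)
_≟ˢ_ = Vec.≡-dec Bool._≟_

isPartition? : (B : Vec (Subset n) n) → Dec (IsPartition B)
isPartition? B =
  Fin.all? (λ i → i ∈? lookup B i) ×-dec
  Fin.all? (λ i → Fin.all? λ j → (j ∈? lookup B i) →-dec (lookup B j ≟ˢ lookup B i))

nonCrossing? : (B : Vec (Subset n) n) → Dec (NonCrossing B)
nonCrossing? B = Fin.all? λ a → Fin.all? λ b → Fin.all? λ c → Fin.all? λ d →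
  (a Fin.<? b) →-dec ((b Fin.<? c) →-dec ((c Fin.<? d) →-dec
  ((c ∈? lookup B a) →-dec ((d ∈? lookup B b) →-dec (b ∈? lookup B a)))))

-- The proofs are irrelevant, so _≡_ on NC n is equality of partitions.

record NC (n : ℕ) : Set where
  constructor nc
  field
    blocks       : Vec (Subset n) n
    .isPartition : IsPartition blocks
    .nonCrossing : NonCrossing blocks

open NC public using (blocks)

block : NC n → Fin n → Subset n
block π = lookup (blocks π)

infix 4 _≟_ _≼_ _≼?_

_≟_ : (π σ : NC n) → Dec (π ≡ σ)
nc B _ _ ≟ nc C _ _ = map′ (λ { ≡.refl → ≡.refl }) (≡.cong blocks) (Vec.≡-dec _≟ˢ_ B C)

-- Every block W of σ (W is block σ i) is the union of the blocks of π
-- that contain a point of W.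

_≼_ : NC n → NC n → Set
π ≼ σ = ∀ i j → j ∈ block σ i → block π j ⊆ block σ i

_≼?_ : (π σ : NC n) → Dec (π ≼ σ)
π ≼? σ = Fin.all? λ i → Fin.all? λ j → (j ∈? block σ i) →-dec (block π j ⊆? block σ i)

own : (π : NC n) → ∀ i → i ∈ block π i
own (nc B p _) i = recompute (i ∈? lookup B i) (proj₁ p i)

block-≡ : (π : NC n) → ∀ {i j} → j ∈ block π i → block π j ≡ block π i
block-≡ (nc B p _) {i} {j} j∈ = recompute (lookup B j ≟ˢ lookup B i) (proj₂ p i j j∈)

block-sym : (π : NC n) → ∀ {i j} → j ∈ block π i → i ∈ block π j
block-sym π {i} j∈ = ≡.subst (i ∈_) (≡.sym (block-≡ π j∈)) (own π i)

block-trans : (π : NC n) → ∀ {i j k} → j ∈ block π i → k ∈ block π j → k ∈ block π i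
block-trans π {k = k} j∈ k∈ = ≡.subst (k ∈_) (block-≡ π j∈) k∈

uncrossed : (π : NC n) → ∀ {a b c d} → a < b → b < c → c < d →
  c ∈ block π a → d ∈ block π b → b ∈ block π a
uncrossed (nc B _ x) {a} {b} {c} {d} p q r s t =
  recompute (b ∈? lookup B a) (x a b c d p q r s t)

-- The non-crossing partition whose blocks are the classes of a given
-- decidable equivalence relation.

∈-tabulate⁺ : {P : Fin n → Set} (P? : ∀ j → Dec (P j)) → ∀ {j} → P j → j ∈ tabulate (does ∘ P?)
∈-tabulate⁺ P? {j} p = Vec.lookup⇒[]= j _ (≡.trans (Vec.lookup∘tabulate _ j) (dec-true (P? j) p))

∈-tabulate⁻ : {P : Fin n → Set} (P? : ∀ j → Dec (P j)) → ∀ {j} → j ∈ tabulate (does ∘ P?) → P j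
∈-tabulate⁻ P? {j} j∈ with P? j | ≡.trans (≡.sym (Vec.lookup∘tabulate (does ∘ P?) j)) (Vec.[]=⇒lookup j∈)
... | yes p | _ = p
... | no _  | ()

record NCEquivalence (n : ℕ) : Set₁ where
  infix 4 _~_ _~?_
  field
    _~_           : Fin n → Fin n → Set
    _~?_          : ∀ i j → Dec (i ~ j)
    isEquivalence : IsEquivalence _~_
    uncross       : ∀ a b c d → a < b → b < c → c < d → a ~ c → b ~ d → a ~ b

  open IsEquivalence isEquivalence public

  class : Fin n → Subset n
  class i = tabulate λ j → does (i ~? j)

  ∈-class⁻ : ∀ {i j} → j ∈ lookup (tabulate class) i → i ~ j
  ∈-class⁻ {i} {j} j∈ =
    ∈-tabulate⁻ (i ~?_) (≡.subst (j ∈_) (Vec.lookup∘tabulate class i) j∈)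

  ∈-class⁺ : ∀ {i j} → i ~ j → j ∈ lookup (tabulate class) i
  ∈-class⁺ {i} {j} p =
    ≡.subst (j ∈_) (≡.sym (Vec.lookup∘tabulate class i)) (∈-tabulate⁺ (i ~?_) p)

  classes : NC n
  classes = nc (tabulate class)
    ( (λ i → ∈-class⁺ refl)
    , (λ i j j∈ → ⊆-antisym (λ k∈ → ∈-class⁺ (trans (∈-class⁻ j∈) (∈-class⁻ k∈)))
                            (λ k∈ → ∈-class⁺ (trans (sym (∈-class⁻ j∈)) (∈-class⁻ k∈)))))
    (λ a b c d p q r s t → ∈-class⁺ (uncross a b c d p q r (∈-class⁻ s) (∈-class⁻ t)))

open NCEquivalence using (classes; ∈-class⁺; ∈-class⁻)

total : NCEquivalence n
total = record { _~_ = λ _ _ → ⊤ ; _~?_ = λ _ _ → yes tt ; isEquivalence = _ ; uncross = _ }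

𝟙 : NC n
𝟙 = classes total

∈-𝟙 : ∀ (i j : Fin n) → j ∈ block 𝟙 i
∈-𝟙 i j = ∈-class⁺ total {i} {j} tt

-- The order-preserving bijection from Fin ∣ W ∣ onto W.

embed : (W : Subset n) → Fin ∣ W ∣ → Fin n
embed (inside  ∷ W) Fin.zero    = Fin.zero
embed (inside  ∷ W) (Fin.suc k) = Fin.suc (embed W k)
embed (outside ∷ W) k           = Fin.suc (embed W k)

embed-∈ : (W : Subset n) → ∀ k → embed W k ∈ W
embed-∈ (inside  ∷ W) Fin.zero    = here
embed-∈ (inside  ∷ W) (Fin.suc k) = there (embed-∈ W k)
embed-∈ (outside ∷ W) k           = there (embed-∈ W k)

embed-mono : (W : Subset n) → ∀ k l → k < l → embed W k < embed W l
embed-mono (inside  ∷ W) Fin.zero    (Fin.suc l) _       = s≤s z≤n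
embed-mono (inside  ∷ W) (Fin.suc k) (Fin.suc l) (s≤s p) = s≤s (embed-mono W k l p)
embed-mono (outside ∷ W) k           l           p       = s≤s (embed-mono W k l p)

infixl 8 _↾_

-- π ↾ W is the restriction π_W.

restriction : NC n → (W : Subset n) → NCEquivalence ∣ W ∣
restriction π W = record
  { _~_           = λ i j → embed W j ∈ block π (embed W i)
  ; _~?_          = λ i j → embed W j ∈? block π (embed W i)
  ; isEquivalence = record { refl = own π _ ; sym = block-sym π ; trans = block-trans π }
  ; uncross       = λ a b c d p q r →
      uncrossed π (embed-mono W a b p) (embed-mono W b c q) (embed-mono W c d r)
  }

_↾_ : NC n → (W : Subset n) → NC ∣ W ∣
π ↾ W = classes (restriction π W)

≼-refl : (π : NC n) → π ≼ π
≼-refl π i j j∈ k∈ = block-trans π j∈ k∈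

≼-𝟙 : (π : NC n) → π ≼ 𝟙
≼-𝟙 π i j _ {k} _ = ∈-𝟙 i k

-- Complete, repetition-free enumerations.

vectors : ∀ {a} {A : Set a} → List A → ∀ n → List (Vec A n)
vectors xs ℕ.zero    = [] ∷ []
vectors xs (ℕ.suc n) = cartesianProductWith _∷_ xs (vectors xs n)

fromBlocks : Vec (Subset n) n → Maybe (NC n)
fromBlocks B with isPartition? B | nonCrossing? B
... | yes p | yes q = just (nc B p q)
... | _     | _     = nothing

allNC : ∀ n → List (NC n)
allNC n = mapMaybe fromBlocks (vectors (vectors (inside ∷ outside ∷ []) n) n)

-- Each block has exactly one leader, its least element.

Leader : NC n → Fin n → Set
Leader σ i = ∀ j → j ∈ block σ i → i ≤ j

leader? : (σ : NC n) → ∀ i → Dec (Leader σ i)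
leader? σ i = Fin.all? λ j → (j ∈? block σ i) →-dec (i Fin.≤? j)

∈⇒nonZero : {W : Subset n} {i : Fin n} → i ∈ W → NonZero ∣ W ∣
∈⇒nonZero {W = inside  ∷ W} _          = _
∈⇒nonZero {W = outside ∷ W} (there i∈) = ∈⇒nonZero i∈

------------------------------------------------------------------------
-- Restrictions to the blocks of a coarser partition, and gluing

nc-≡ : ∀ {π σ : NC n} → blocks π ≡ blocks σ → π ≡ σ
nc-≡ {π = nc _ _ _} {nc _ _ _} ≡.refl = ≡.refl

NC-ext : ∀ {π σ : NC n} → (∀ {i j} → j ∈ block π i → j ∈ block σ i) →
  (∀ {i j} → j ∈ block σ i → j ∈ block π i) → π ≡ σ
NC-ext {π = π} {σ} to from = nc-≡
  (≡.trans (≡.sym (Vec.tabulate∘lookup (blocks π)))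
  (≡.trans (Vec.tabulate-cong λ i → ⊆-antisym (to {i}) (from {i}))
  (Vec.tabulate∘lookup (blocks σ))))

≼⇒ : {π σ : NC n} → π ≼ σ → ∀ {i j} → j ∈ block π i → j ∈ block σ i
≼⇒ {σ = σ} π≼σ {i} = π≼σ i i (own σ i)

⇒≼ : {π σ : NC n} → (∀ {i j} → j ∈ block π i → j ∈ block σ i) → π ≼ σ
⇒≼ {σ = σ} f i j j∈ k∈ = block-trans σ j∈ (f k∈)

≼-antisym : {π σ : NC n} → π ≼ σ → σ ≼ π → π ≡ σ
≼-antisym {π = π} {σ} p q = NC-ext (≼⇒ {π = π} {σ} p) (≼⇒ {π = σ} {π} q)

module _ (π : NC n) (W : Subset n) where

  ∈-↾⁻ : ∀ {i j} → j ∈ block (π ↾ W) i → embed W j ∈ block π (embed W i)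
  ∈-↾⁻ = ∈-class⁻ (restriction π W)

  ∈-↾⁺ : ∀ {i j} → embed W j ∈ block π (embed W i) → j ∈ block (π ↾ W) i
  ∈-↾⁺ = ∈-class⁺ (restriction π W)

≼-↾ : (π σ : NC n) (W : Subset n) → π ≼ σ → π ↾ W ≼ σ ↾ W
≼-↾ π σ W π≼σ = ⇒≼ {π = π ↾ W} {σ ↾ W}
  λ j∈ → ∈-↾⁺ σ W (≼⇒ {π = π} {σ} π≼σ (∈-↾⁻ π W j∈))

least : {W : Subset n} {i : Fin n} → i ∈ W → ∃ λ k → k ∈ W × (∀ j → j ∈ W → k ≤ j)
least {W = inside  ∷ W} _          = Fin.zero , here , λ _ _ → z≤n
least {W = outside ∷ W} (there i∈) with least i∈
... | k , k∈ , min = Fin.suc k , there k∈ , λ { (Fin.suc j) (there j∈) → s≤s (min j j∈) }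

leaderOf : (σ : NC n) (i : Fin n) → ∃ λ w → Leader σ w × i ∈ block σ w
leaderOf σ i with least (own σ i)
... | w , w∈ , min =
  w , (λ j j∈ → min j (block-trans σ w∈ j∈)) , block-sym σ w∈

leader-unique : (σ : NC n) → ∀ {v w i} → Leader σ v → Leader σ w →
  i ∈ block σ v → i ∈ block σ w → v ≡ w
leader-unique σ lv lw i∈v i∈w = Fin.≤-antisym
  (lv _ (block-trans σ i∈v (block-sym σ i∈w)))
  (lw _ (block-trans σ i∈w (block-sym σ i∈v)))

unembed : (W : Subset n) → ∀ {i} → i ∈ W → ∃ λ k → embed W k ≡ i
unembed (inside  ∷ W) here       = Fin.zero , ≡.refl
unembed (inside  ∷ W) (there i∈) with unembed W i∈
... | k , e = Fin.suc k , ≡.cong Fin.suc e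
unembed (outside ∷ W) (there i∈) with unembed W i∈
... | k , e = k , ≡.cong Fin.suc e

embed-injective : (W : Subset n) → ∀ {k l} → embed W k ≡ embed W l → k ≡ l
embed-injective (inside  ∷ W) {Fin.zero}  {Fin.zero}  _ = ≡.refl
embed-injective (inside  ∷ W) {Fin.suc k} {Fin.suc l} e =
  ≡.cong Fin.suc (embed-injective W (Fin.suc-injective e))
embed-injective (outside ∷ W)                         e =
  embed-injective W (Fin.suc-injective e)

embed-cancel-< : (W : Subset n) → ∀ k l → embed W k < embed W l → k < l
embed-cancel-< (inside  ∷ W) Fin.zero    (Fin.suc l) _       = s≤s z≤n
embed-cancel-< (inside  ∷ W) (Fin.suc k) (Fin.suc l) (s≤s p) = s≤s (embed-cancel-< W k l p)
embed-cancel-< (outside ∷ W) k           l           (s≤s p) = embed-cancel-< W k l p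

module _ (ρ : NC n) (W : Subset n) where

  leader-↾⁻ : ∀ k → block ρ (embed W k) ⊆ W → Leader (ρ ↾ W) k → Leader ρ (embed W k)
  leader-↾⁻ k sub lead j j∈ with unembed W (sub j∈)
  ... | l , ≡.refl = ℕ.≮⇒≥ λ p →
    ℕ.<⇒≱ (embed-cancel-< W l k p) (lead l (∈-↾⁺ ρ W j∈))

  leader-↾⁺ : ∀ k → Leader ρ (embed W k) → Leader (ρ ↾ W) k
  leader-↾⁺ k lead l l∈ = ℕ.≮⇒≥ λ p →
    ℕ.<⇒≱ (embed-mono W l k p) (lead (embed W l) (∈-↾⁻ ρ W l∈))

-- If V ⊆ W then (π ↾ W) ↾ (V inside W) is π ↾ V.

within : (W V : Subset n) → Subset ∣ W ∣
within W V = tabulate λ l → does (embed W l ∈? V)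

block-↾ : (ρ : NC n) (W : Subset n) → ∀ k → block (ρ ↾ W) k ≡ within W (block ρ (embed W k))
block-↾ ρ W k = Vec.lookup∘tabulate _ k

embed-within : (W V : Subset n) → V ⊆ W → Σ (∣ within W V ∣ ≡ ∣ V ∣) λ eq →
  ∀ k → embed W (embed (within W V) k) ≡ embed V (Fin.cast eq k)
embed-within []            []            sub = ≡.refl , λ ()
embed-within (outside ∷ W) (inside  ∷ V) sub with () ← sub here
embed-within (outside ∷ W) (outside ∷ V) sub
  with embed-within W V (λ i∈ → drop (sub (there i∈)))
  where
  drop : ∀ {s i} → Fin.suc i ∈ s ∷ W → i ∈ W
  drop (there i∈) = i∈
... | eq , e = eq , λ k → ≡.cong Fin.suc (e k)
embed-within (inside  ∷ W) (outside ∷ V) sub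
  with embed-within W V (λ i∈ → drop (sub (there i∈)))
  where
  drop : ∀ {s i} → Fin.suc i ∈ s ∷ W → i ∈ W
  drop (there i∈) = i∈
... | eq , e = eq , λ k → ≡.cong Fin.suc (e k)
embed-within (inside  ∷ W) (inside  ∷ V) sub
  with embed-within W V (λ i∈ → drop (sub (there i∈)))
  where
  drop : ∀ {s i} → Fin.suc i ∈ s ∷ W → i ∈ W
  drop (there i∈) = i∈
... | eq , e = ≡.cong ℕ.suc eq , λ where
  Fin.zero    → ≡.refl
  (Fin.suc k) → ≡.cong Fin.suc (e k)

↾-↾ : (π : NC n) (W V : Subset n) → V ⊆ W →
  _≡_ {A = Σ ℕ NC} (∣ within W V ∣ , π ↾ W ↾ within W V) (∣ V ∣ , π ↾ V)
↾-↾ π W V sub = go (proj₁ same) (proj₂ same) (π ↾ W ↾ U) (π ↾ V)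
    (λ j∈ → ∈-↾⁻ π W (∈-↾⁻ (π ↾ W) U j∈)) (λ j∈ → ∈-↾⁺ (π ↾ W) U (∈-↾⁺ π W j∈))
    (∈-↾⁻ π V) (∈-↾⁺ π V)
  where
  U = within W V
  same = embed-within W V sub

  go : ∀ {m m′} {f : Fin m → Fin _} {f′ : Fin m′ → Fin _} (eq : m ≡ m′) →
    (∀ k → f k ≡ f′ (Fin.cast eq k)) → (ρ : NC m) (ρ′ : NC m′) →
    (∀ {i j} → j ∈ block ρ i → f j ∈ block π (f i)) →
    (∀ {i j} → f j ∈ block π (f i) → j ∈ block ρ i) →
    (∀ {i j} → j ∈ block ρ′ i → f′ j ∈ block π (f′ i)) →
    (∀ {i j} → f′ j ∈ block π (f′ i) → j ∈ block ρ′ i) →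
    _≡_ {A = Σ ℕ NC} (m , ρ) (m′ , ρ′)
  go {m} {f = f} {f′} ≡.refl e ρ ρ′ a b a′ b′ = ≡.cong (m ,_) (NC-ext
    (λ {i} {j} j∈ → b′ (≡.subst₂ (λ x y → x ∈ block π y) (e′ j) (e′ i) (a j∈)))
    (λ {i} {j} j∈ → b (≡.subst₂ (λ x y → x ∈ block π y) (≡.sym (e′ j)) (≡.sym (e′ i)) (a′ j∈))))
    where
    e′ : ∀ k → f k ≡ f′ k
    e′ k = ≡.trans (e k) (≡.cong f′ (Fin.cast-is-id ≡.refl k))

-- Partitions of the blocks of σ glue to a partition below σ.

module _ (σ : NC n) (τ : ∀ w → NC ∣ block σ w ∣) where

  Glued : Fin n → Fin n → Set
  Glued i j = ∃ λ w → Leader σ w ×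
    ∃ λ k → embed (block σ w) k ≡ i ×
    ∃ λ l → embed (block σ w) l ≡ j × l ∈ block (τ w) k

  glued? : ∀ i j → Dec (Glued i j)
  glued? i j = Fin.any? λ w → leader? σ w ×-dec
    Fin.any? λ k → (embed (block σ w) k Fin.≟ i) ×-dec
    Fin.any? λ l → (embed (block σ w) l Fin.≟ j) ×-dec (l ∈? block (τ w) k)

  private
    same : ∀ {w} → Leader σ w → ∀ {k l} → Glued (embed (block σ w) k) (embed (block σ w) l) →
      l ∈ block (τ w) k
    same {w} lw {k} (w′ , lw′ , k′ , ek , l′ , el , l∈)
      with leader-unique σ lw lw′ (embed-∈ (block σ w) k)
             (≡.subst (_∈ block σ w′) ek (embed-∈ (block σ w′) k′))
    ... | ≡.refl with embed-injective (block σ w) ek | embed-injective (block σ w) el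
    ... | ≡.refl | ≡.refl = l∈

  gluing : NCEquivalence n
  gluing = record
    { _~_ = Glued
    ; _~?_ = glued?
    ; isEquivalence = record { refl = refl′ ; sym = sym′ ; trans = trans′ }
    ; uncross = uncross′
    }
    where
    refl′ : ∀ {i} → Glued i i
    refl′ {i} with leaderOf σ i
    ... | w , lw , i∈ with unembed (block σ w) i∈
    ... | k , e = w , lw , k , e , k , e , own (τ w) k

    sym′ : ∀ {i j} → Glued i j → Glued j i
    sym′ (w , lw , k , ek , l , el , l∈) = w , lw , l , el , k , ek , block-sym (τ w) l∈

    meet : ∀ {w w′ k k′} → Leader σ w → Leader σ w′ →
      embed (block σ w) k ∈ block σ (embed (block σ w′) k′) → w ≡ w′
    meet {w} {w′} {k} {k′} lw lw′ h = leader-unique σ lw lw′ (embed-∈ (block σ w) k)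
      (block-trans σ (embed-∈ (block σ w′) k′) h)

    trans′ : ∀ {i j k} → Glued i j → Glued j k → Glued i k
    trans′ (w , lw , a , ≡.refl , b , ≡.refl , b∈) (w′ , lw′ , b′ , eb , d , ≡.refl , d∈)
      with meet {k = b} {b′} lw lw′ (≡.subst (_ ∈_) (≡.cong (block σ) (≡.sym eb)) (own σ _))
    ... | ≡.refl with embed-injective (block σ w) eb
    ... | ≡.refl = w , lw , a , ≡.refl , d , ≡.refl , block-trans (τ w) b∈ d∈

    uncross′ : ∀ a b c d → a < b → b < c → c < d → Glued a c → Glued b d → Glued a b
    uncross′ _ _ _ _ p q r
      (w , lw , a , ≡.refl , c , ≡.refl , c∈) (w′ , lw′ , b , ≡.refl , d , ≡.refl , d∈)
      with meet {k = b} {a} lw′ lw (uncrossed σ p q r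
             (block-trans σ (block-sym σ (embed-∈ (block σ w) a)) (embed-∈ (block σ w) c))
             (block-trans σ (block-sym σ (embed-∈ (block σ w′) b)) (embed-∈ (block σ w′) d)))
    ... | ≡.refl = w , lw , a , ≡.refl , b , ≡.refl , uncrossed (τ w)
      (embed-cancel-< (block σ w) a b p) (embed-cancel-< (block σ w) b c q)
      (embed-cancel-< (block σ w) c d r) c∈ d∈

  abstract

    glue : NC n
    glue = classes gluing

    glue-≼ : glue ≼ σ
    glue-≼ = ⇒≼ {π = glue} {σ} λ j∈ → go (∈-class⁻ gluing j∈)
      where
      go : ∀ {i j} → Glued i j → j ∈ block σ i
      go (w , _ , k , ≡.refl , l , ≡.refl , _) =
        block-trans σ (block-sym σ (embed-∈ (block σ w) k)) (embed-∈ (block σ w) l)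

    glue-↾ : ∀ w → Leader σ w → glue ↾ block σ w ≡ τ w
    glue-↾ w lw = NC-ext
      (λ {k} {l} l∈ → same lw (∈-class⁻ gluing (∈-↾⁻ glue (block σ w) l∈)))
      (λ {k} {l} l∈ → ∈-↾⁺ glue (block σ w)
        (∈-class⁺ gluing (w , lw , k , ≡.refl , l , ≡.refl , l∈)))

-- A partition below σ is determined by its restrictions to the blocks of σ.

≼-from-↾ : (π ρ σ : NC n) → π ≼ σ →
  (∀ w → Leader σ w → π ↾ block σ w ≼ ρ ↾ block σ w) → π ≼ ρ
≼-from-↾ π ρ σ π≼σ h = ⇒≼ {π = π} {ρ} go
  where
  go : ∀ {i j} → j ∈ block π i → j ∈ block ρ i
  go {i} {j} j∈ with leaderOf σ i
  ... | w , lw , i∈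
    with unembed (block σ w) i∈
       | unembed (block σ w) (block-trans σ i∈ (≼⇒ {π = π} {σ} π≼σ j∈))
  ... | k , ≡.refl | l , ≡.refl = ∈-↾⁻ ρ (block σ w)
    (≼⇒ {π = π ↾ block σ w} {ρ ↾ block σ w} (h w lw) (∈-↾⁺ π (block σ w) j∈))

≡-from-↾ : (π ρ σ : NC n) → π ≼ σ → ρ ≼ σ →
  (∀ w → Leader σ w → π ↾ block σ w ≡ ρ ↾ block σ w) → π ≡ ρ
≡-from-↾ π ρ σ π≼σ ρ≼σ h = ≼-antisym
  (≼-from-↾ π ρ σ π≼σ λ w lw → ≡.subst (π ↾ block σ w ≼_) (h w lw) (≼-refl (π ↾ block σ w)))
  (≼-from-↾ ρ π σ ρ≼σ λ w lw → ≡.subst (_≼ π ↾ block σ w) (h w lw) (≼-refl (π ↾ block σ w)))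

------------------------------------------------------------------------
-- Finite sums and products, as iterations of the operation of a
-- commutative monoid

module BigOperators {a ℓ} (M : CommutativeMonoid a ℓ) where

  open CommutativeMonoid M
  open FinSum M public using (sum)

  when : ∀ {p} {P : Set p} → Dec P → (.P → Carrier) → Carrier
  when (yes p) f = f p
  when (no _)  f = ε

  ⨁ : ∀ {x} {A : Set x} → List A → (A → Carrier) → Carrier
  ⨁ xs f = foldr (λ x → f x ∙_) ε xs

  -- The iterated operation applied to F W for the blocks W of σ.

  overBlocks : NC n → ((W : Subset n) → .⦃ NonZero ∣ W ∣ ⦄ → Carrier) → Carrier
  overBlocks σ F = sum λ i →
    when (leader? σ i) λ _ → F (block σ i) ⦃ ∈⇒nonZero (own σ i) ⦄

  when-yes : ∀ {p} {P : Set p} (P? : Dec P) {f : .P → Carrier} (p : P) → when P? f ≈ f p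
  when-yes (yes _)  p = refl
  when-yes (no ¬p)  p = contradiction p ¬p

  when-no : ∀ {p} {P : Set p} (P? : Dec P) {f : .P → Carrier} → ¬ P → when P? f ≈ ε
  when-no (yes p) ¬p = contradiction p ¬p
  when-no (no _)  ¬p = refl

  when-cong : ∀ {p} {P : Set p} (P? : Dec P) {f g : .P → Carrier} →
    (∀ (p : P) → f p ≈ g p) → when P? f ≈ when P? g
  when-cong (yes p) e = e p
  when-cong (no _)  e = refl

  when-ε : ∀ {p} {P : Set p} (P? : Dec P) → when P? (λ _ → ε) ≈ ε
  when-ε (yes _) = refl
  when-ε (no _)  = refl

  when-map′ : ∀ {p q} {P : Set p} {Q : Set q} (P? : Dec P) {to : P → Q} {from : Q → P} {x} →
    when (map′ to from P?) (λ _ → x) ≈ when P? (λ _ → x)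
  when-map′ (yes _) = refl
  when-map′ (no _)  = refl

  sum-cong : ∀ {n} {f g : Fin n → Carrier} → (∀ i → f i ≈ g i) → sum f ≈ sum g
  sum-cong = FinSum.sum-cong-≋ M

  sum-ε : ∀ {n} (f : Fin n → Carrier) → (∀ i → f i ≈ ε) → sum f ≈ ε
  sum-ε {n} f e = trans (sum-cong e) (FinSum.sum-replicate-zero M n)

  sum-single : ∀ {n} (f : Fin n → Carrier) i → (∀ j → j ≢ i → f j ≈ ε) → sum f ≈ f i
  sum-single f Fin.zero    e =
    trans (∙-congˡ (sum-ε (f ∘ Fin.suc) λ j → e (Fin.suc j) λ ())) (identityʳ _)
  sum-single f (Fin.suc i) e = trans (∙-cong (e Fin.zero λ ())
    (sum-single (f ∘ Fin.suc) i λ j j≢i → e (Fin.suc j) (j≢i ∘ Fin.suc-injective)))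
    (identityˡ _)

  when-sum : ∀ {p} {P : Set p} (P? : Dec P) {n} (f : Fin n → Carrier) →
    when P? (λ _ → sum f) ≈ sum λ i → when P? λ _ → f i
  when-sum (yes _) f = refl
  when-sum (no _)  {n} f = sym (sum-ε {n} (λ _ → ε) λ _ → refl)

  sum-embed : (W : Subset n) (f : Fin n → Carrier) →
    sum (f ∘ embed W) ≈ sum λ i → when (i ∈? W) λ _ → f i
  sum-embed []            f = refl
  sum-embed (inside  ∷ W) f = ∙-congˡ
    (trans (sum-embed W (f ∘ Fin.suc)) (sum-cong λ i → sym (when-map′ (i ∈? W))))
  sum-embed (outside ∷ W) f = trans
    (trans (sum-embed W (f ∘ Fin.suc)) (sum-cong λ i → sym (when-map′ (i ∈? W))))
    (sym (identityˡ _))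

  sum-by-blocks : (σ : NC n) (f : Fin n → Carrier) →
    sum (λ i → when (leader? σ i) λ _ → sum (f ∘ embed (block σ i))) ≈ sum f
  sum-by-blocks σ f = begin
    sum (λ i → when (leader? σ i) λ _ → sum (f ∘ embed (block σ i)))
      ≈⟨ sum-cong (λ i → trans (when-cong (leader? σ i) λ _ → sum-embed (block σ i) f)
                               (when-sum (leader? σ i) λ j → when (j ∈? block σ i) λ _ → f j)) ⟩
    sum (λ i → sum λ j → when (leader? σ i) λ _ → when (j ∈? block σ i) λ _ → f j)
      ≈⟨ FinSum.∑-comm M (λ i j → when (leader? σ i) λ _ → when (j ∈? block σ i) λ _ → f j) ⟩
    sum (λ j → sum λ i → when (leader? σ i) λ _ → when (j ∈? block σ i) λ _ → f j)
      ≈⟨ sum-cong single ⟩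
    sum f ∎
    where
    open SetoidReasoning setoid
    single : ∀ j → sum (λ i → when (leader? σ i) λ _ → when (j ∈? block σ i) λ _ → f j) ≈ f j
    single j with leaderOf σ j
    ... | w , lw , j∈ = trans
      (sum-single _ w λ i i≢w → trans (when-cong (leader? σ i) λ li →
        when-no (j ∈? block σ i) λ j∈i → i≢w (leader-unique σ li lw j∈i j∈))
        (when-ε (leader? σ i)))
      (trans (when-yes (leader? σ w) lw) (when-yes (j ∈? block σ w) j∈))

  ⨁-cong : ∀ {x} {A : Set x} (xs : List A) {f g : A → Carrier} →
    (∀ x → f x ≈ g x) → ⨁ xs f ≈ ⨁ xs g
  ⨁-cong []       e = refl
  ⨁-cong (x ∷ xs) e = ∙-cong (e x) (⨁-cong xs e)

  ⨁-ε : ∀ {x} {A : Set x} (xs : List A) {f : A → Carrier} → (∀ x → f x ≈ ε) → ⨁ xs f ≈ ε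
  ⨁-ε []       e = refl
  ⨁-ε (x ∷ xs) e = trans (∙-cong (e x) (⨁-ε xs e)) (identityˡ _)

  ⨁-∙ : ∀ {x} {A : Set x} (xs : List A) (f g : A → Carrier) →
    ⨁ xs (λ x → f x ∙ g x) ≈ ⨁ xs f ∙ ⨁ xs g
  ⨁-∙ []       f g = sym (identityˡ _)
  ⨁-∙ (x ∷ xs) f g = trans (∙-congˡ (⨁-∙ xs f g)) (interchange _ _ _ _)
    where open CommutativeSemigroupProperties commutativeSemigroup

  ⨁-++ : ∀ {x} {A : Set x} (xs ys : List A) (f : A → Carrier) →
    ⨁ (xs ++ ys) f ≈ ⨁ xs f ∙ ⨁ ys f
  ⨁-++ []       ys f = sym (identityˡ _)
  ⨁-++ (x ∷ xs) ys f = trans (∙-congˡ (⨁-++ xs ys f)) (sym (assoc _ _ _))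

  ⨁-map : ∀ {x y} {A : Set x} {B : Set y} (h : A → B) (xs : List A) (f : B → Carrier) →
    ⨁ (map h xs) f ≈ ⨁ xs (f ∘ h)
  ⨁-map h []       f = refl
  ⨁-map h (x ∷ xs) f = ∙-congˡ (⨁-map h xs f)

  ⨁-mapMaybe : ∀ {x y} {A : Set x} {B : Set y} (h : A → Maybe B) (xs : List A) (f : B → Carrier) →
    ⨁ (mapMaybe h xs) f ≈ ⨁ xs (maybe f ε ∘ h)
  ⨁-mapMaybe h []       f = refl
  ⨁-mapMaybe h (x ∷ xs) f with h x
  ... | just y  = ∙-congˡ (⨁-mapMaybe h xs f)
  ... | nothing = trans (⨁-mapMaybe h xs f) (sym (identityˡ _))

  -- xs contains every element of A exactly once.

  Enumerates : ∀ {x} {A : Set x} → List A → Set (a ⊔ ℓ ⊔ x)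
  Enumerates xs = ∀ f x → (∀ y → y ≢ x → f y ≈ ε) → ⨁ xs f ≈ f x

  enum-vectors : ∀ {x} {A : Set x} {xs : List A} → Enumerates xs → ∀ n → Enumerates (vectors xs n)
  enum-vectors enum ℕ.zero    f []       e = identityʳ _
  enum-vectors {xs = xs} enum (ℕ.suc n) f (v ∷ vs) e = trans (product xs) (trans
    (enum (λ x → ⨁ (vectors xs n) (λ ws → f (x ∷ ws))) v
      λ x x≢v → ⨁-ε (vectors xs n) λ ws → e (x ∷ ws) (x≢v ∘ Vec.∷-injectiveˡ))
    (enum-vectors enum n (λ ws → f (v ∷ ws)) vs λ ws ws≢vs → e (v ∷ ws) (ws≢vs ∘ Vec.∷-injectiveʳ)))
    where
    product : ∀ ys → ⨁ (cartesianProductWith _∷_ ys (vectors xs n)) f ≈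
      ⨁ ys λ y → ⨁ (vectors xs n) λ ws → f (y ∷ ws)
    product []       = refl
    product (y ∷ ys) = trans (⨁-++ (map (y ∷_) (vectors xs n)) _ f)
      (∙-cong (⨁-map (y ∷_) (vectors xs n) f) (product ys))

  enum-NC : ∀ n → Enumerates (allNC n)
  enum-NC n f π e = trans (⨁-mapMaybe fromBlocks (vectors (vectors (inside ∷ outside ∷ []) n) n) f) (trans
    (enum-vectors (enum-vectors enum-sides n) n (maybe f ε ∘ fromBlocks) (blocks π)
      λ B B≢ → other B B≢)
    (same π))
    where
    enum-sides : Enumerates (inside ∷ outside ∷ [])
    enum-sides f true  e = trans (∙-congˡ (trans (∙-congʳ (e false λ ())) (identityˡ _))) (identityʳ _)
    enum-sides f false e = trans (∙-cong (e true λ ()) (identityʳ _)) (identityˡ _)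

    other : ∀ B → B ≢ blocks π → maybe f ε (fromBlocks B) ≈ ε
    other B B≢ with isPartition? B | nonCrossing? B
    ... | yes p | yes q = e (nc B p q) (B≢ ∘ ≡.cong blocks)
    ... | yes _ | no _  = refl
    ... | no _  | _     = refl

    same : ∀ π → maybe f ε (fromBlocks (blocks π)) ≈ f π
    same (nc B p q) with isPartition? B | nonCrossing? B
    ... | yes _ | yes _ = refl
    ... | yes _ | no ¬q = contradiction-irr q ¬q
    ... | no ¬p | _     = contradiction-irr p ¬p

------------------------------------------------------------------------
-- Commutative algebras over a commutative ring K, in the role of ℂ

ringHomomorphism : ∀ {a ℓ b ℓ′} (A : CommutativeRing a ℓ) (B : CommutativeRing b ℓ′) →
  let module A = CommutativeRing A; module B = CommutativeRing B in
  (f : A.Carrier → B.Carrier) →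
  (∀ {x y} → x A.≈ y → f x B.≈ f y) →
  (∀ x y → f (x A.+ y) B.≈ f x B.+ f y) →
  (∀ x y → f (x A.* y) B.≈ f x B.* f y) →
  f A.1# B.≈ B.1# →
  IsRingHomomorphism A.rawRing B.rawRing f
ringHomomorphism A B f cong +-homo *-homo 1-homo = record
  { isSemiringHomomorphism = record
    { isNearSemiringHomomorphism = record
      { +-isMonoidHomomorphism = record
        { isMagmaHomomorphism = record
          { isRelHomomorphism = record { cong = cong } ; homo = +-homo }
        ; ε-homo = 0-homo
        }
      ; *-homo = *-homo
      }
    ; 1#-homo = 1-homo
    }
  ; -‿homo = λ x → P.⁻¹-uniqueˡ (f (A.- x)) (f x)
      (B.trans (B.sym (+-homo _ _)) (B.trans (cong (A.-‿inverseˡ x)) 0-homo))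
  }
  where
  module A = CommutativeRing A
  module B = CommutativeRing B
  module P = AbelianGroupProperties B.+-abelianGroup renaming (inverseˡ-unique to ⁻¹-uniqueˡ)
  0-homo : f A.0# B.≈ B.0#
  0-homo = P.identityˡ-unique (f A.0#) (f A.0#)
    (B.trans (B.sym (+-homo _ _)) (cong (A.+-identityˡ _)))

module _ {c ℓ} (K : CommutativeRing c ℓ) where

  private
    module K = CommutativeRing K

  record Algebra a ℓ′ : Set (c ⊔ ℓ ⊔ suc (a ⊔ ℓ′)) where
    field
      commutativeRing : CommutativeRing a ℓ′
    open CommutativeRing commutativeRing public
    field
      η                    : K.Carrier → Carrier
      η-isRingHomomorphism : IsRingHomomorphism K.rawRing rawRing η
    open IsRingHomomorphism η-isRingHomomorphism public using ()
      renaming (⟦⟧-cong to η-cong; +-homo to η-+; *-homo to η-*; 0#-homo to η-0; 1#-homo to η-1)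

  record Hom {a ℓ₁ b ℓ₂} (A : Algebra a ℓ₁) (B : Algebra b ℓ₂) :
      Set (c ⊔ a ⊔ ℓ₁ ⊔ b ⊔ ℓ₂) where
    private
      module A = Algebra A
      module B = Algebra B
    field
      ⟦_⟧                : A.Carrier → B.Carrier
      isRingHomomorphism : IsRingHomomorphism A.rawRing B.rawRing ⟦_⟧
      η-homo             : ∀ k → ⟦ A.η k ⟧ B.≈ B.η k
    open IsRingHomomorphism isRingHomomorphism public

  infixr 9 _∘ʰ_

  _∘ʰ_ : ∀ {a ℓ₁ b ℓ₂ d ℓ₃} {A : Algebra a ℓ₁} {B : Algebra b ℓ₂} {C : Algebra d ℓ₃} →
    Hom B C → Hom A B → Hom A C
  _∘ʰ_ {A = A} {C = C} g f = record
    { ⟦_⟧ = λ x → g.⟦ f.⟦ x ⟧ ⟧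
    ; isRingHomomorphism = ringHomomorphism A.commutativeRing C.commutativeRing _
        (λ e → g.⟦⟧-cong (f.⟦⟧-cong e))
        (λ x y → C.trans (g.⟦⟧-cong (f.+-homo x y)) (g.+-homo _ _))
        (λ x y → C.trans (g.⟦⟧-cong (f.*-homo x y)) (g.*-homo _ _))
        (C.trans (g.⟦⟧-cong f.1#-homo) g.1#-homo)
    ; η-homo = λ k → C.trans (g.⟦⟧-cong (f.η-homo k)) (g.η-homo k)
    }
    where
    module A = Algebra A
    module C = Algebra C
    module f = Hom f renaming (⟦_⟧ to infix 10 ⟦_⟧)
    module g = Hom g renaming (⟦_⟧ to infix 10 ⟦_⟧)

  base : Algebra c ℓ
  base = record
    { commutativeRing      = K
    ; η                    = id
    ; η-isRingHomomorphism = ringHomomorphism K K id id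
        (λ _ _ → K.refl) (λ _ _ → K.refl) K.refl
    }

  ----------------------------------------------------------------------
  -- Polynomials: expressions in the variables V, modulo the axioms of
  -- commutative K-algebras

  infixl 6 _:+_
  infixl 7 _:*_
  infix  8 :-_
  infix  4 _≈ᵖ_

  data Poly {v} (V : Set v) : Set (c ⊔ v) where
    con       : K.Carrier → Poly V
    var       : V → Poly V
    _:+_ _:*_ : Poly V → Poly V → Poly V
    :-_       : Poly V → Poly V

  data _≈ᵖ_ {v} {V : Set v} : Poly V → Poly V → Set (c ⊔ ℓ ⊔ v) where
    refl        : ∀ {p} → p ≈ᵖ p
    sym         : ∀ {p q} → p ≈ᵖ q → q ≈ᵖ p
    trans       : ∀ {p q r} → p ≈ᵖ q → q ≈ᵖ r → p ≈ᵖ r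
    +-cong      : ∀ {p p′ q q′} → p ≈ᵖ p′ → q ≈ᵖ q′ → p :+ q ≈ᵖ p′ :+ q′
    *-cong      : ∀ {p p′ q q′} → p ≈ᵖ p′ → q ≈ᵖ q′ → p :* q ≈ᵖ p′ :* q′
    -‿cong      : ∀ {p p′} → p ≈ᵖ p′ → :- p ≈ᵖ :- p′
    +-assoc     : ∀ p q r → (p :+ q) :+ r ≈ᵖ p :+ (q :+ r)
    +-comm      : ∀ p q → p :+ q ≈ᵖ q :+ p
    +-identityˡ : ∀ p → con K.0# :+ p ≈ᵖ p
    -‿inverseˡ  : ∀ p → :- p :+ p ≈ᵖ con K.0#
    *-assoc     : ∀ p q r → (p :* q) :* r ≈ᵖ p :* (q :* r)
    *-comm      : ∀ p q → p :* q ≈ᵖ q :* p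
    *-identityˡ : ∀ p → con K.1# :* p ≈ᵖ p
    distribˡ    : ∀ p q r → p :* (q :+ r) ≈ᵖ p :* q :+ p :* r
    con-cong    : ∀ {x y} → x K.≈ y → con x ≈ᵖ con y
    con-+       : ∀ x y → con (x K.+ y) ≈ᵖ con x :+ con y
    con-*       : ∀ x y → con (x K.* y) ≈ᵖ con x :* con y

  polyRing : ∀ {v} → Set v → CommutativeRing (c ⊔ v) (c ⊔ ℓ ⊔ v)
  polyRing V = record
    { Carrier = Poly V
    ; _≈_ = _≈ᵖ_
    ; _+_ = _:+_
    ; _*_ = _:*_
    ; -_ = :-_
    ; 0# = con K.0#
    ; 1# = con K.1#
    ; isCommutativeRing = record
      { isRing = record
        { +-isAbelianGroup = record
          { isGroup = record
            { isMonoid = record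
              { isSemigroup = record
                { isMagma = record
                  { isEquivalence = record { refl = refl ; sym = sym ; trans = trans }
                  ; ∙-cong = +-cong
                  }
                ; assoc = +-assoc
                }
              ; identity = +-identityˡ , λ p → trans (+-comm _ _) (+-identityˡ p)
              }
            ; inverse = -‿inverseˡ , λ p → trans (+-comm _ _) (-‿inverseˡ p)
            ; ⁻¹-cong = -‿cong
            }
          ; comm = +-comm
          }
        ; *-cong = *-cong
        ; *-assoc = *-assoc
        ; *-identity = *-identityˡ , λ p → trans (*-comm _ _) (*-identityˡ p)
        ; distrib = distribˡ , λ p q r →
            trans (*-comm _ _) (trans (distribˡ _ _ _) (+-cong (*-comm _ _) (*-comm _ _)))
        }
      ; *-comm = *-comm
      }
    }

  polynomials : ∀ {v} → Set v → Algebra (c ⊔ v) (c ⊔ ℓ ⊔ v)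
  polynomials V = record
    { commutativeRing      = polyRing V
    ; η                    = con
    ; η-isRingHomomorphism = ringHomomorphism K (polyRing V) con con-cong con-+ con-* refl
    }

  -- The homomorphism with prescribed values on the variables.

  module _ {v a ℓ′} {V : Set v} (A : Algebra a ℓ′) (f : V → Algebra.Carrier A) where

    private
      module A = Algebra A

    eval : Poly V → A.Carrier
    eval (con k)  = A.η k
    eval (var x)  = f x
    eval (p :+ q) = eval p A.+ eval q
    eval (p :* q) = eval p A.* eval q
    eval (:- p)   = A.- eval p

    eval-cong : ∀ {p q} → p ≈ᵖ q → eval p A.≈ eval q
    eval-cong refl              = A.refl
    eval-cong (sym e)           = A.sym (eval-cong e)
    eval-cong (trans e e′)      = A.trans (eval-cong e) (eval-cong e′)
    eval-cong (+-cong e e′)     = A.+-cong (eval-cong e) (eval-cong e′)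
    eval-cong (*-cong e e′)     = A.*-cong (eval-cong e) (eval-cong e′)
    eval-cong (-‿cong e)        = A.-‿cong (eval-cong e)
    eval-cong (+-assoc p q r)   = A.+-assoc _ _ _
    eval-cong (+-comm p q)      = A.+-comm _ _
    eval-cong (+-identityˡ p)   = A.trans (A.+-congʳ A.η-0) (A.+-identityˡ _)
    eval-cong (-‿inverseˡ p)    = A.trans (A.-‿inverseˡ _) (A.sym A.η-0)
    eval-cong (*-assoc p q r)   = A.*-assoc _ _ _
    eval-cong (*-comm p q)      = A.*-comm _ _
    eval-cong (*-identityˡ p)   = A.trans (A.*-congʳ A.η-1) (A.*-identityˡ _)
    eval-cong (distribˡ p q r)  = A.distribˡ _ _ _
    eval-cong (con-cong e)      = A.η-cong e
    eval-cong (con-+ x y)       = A.η-+ x y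
    eval-cong (con-* x y)       = A.η-* x y

    extend : Hom (polynomials V) A
    extend = record
      { ⟦_⟧                = eval
      ; isRingHomomorphism = ringHomomorphism (polyRing V) A.commutativeRing eval eval-cong
          (λ _ _ → A.refl) (λ _ _ → A.refl) A.η-1
      ; η-homo             = λ _ → A.refl
      }

  ----------------------------------------------------------------------
  -- Tensor products over K: the abelian group generated by the elements
  -- a ⊗ b, modulo biadditivity and η k * a ⊗ b ≈ a ⊗ η k * b, with the
  -- multiplication determined by (a ⊗ b) * (a′ ⊗ b′) = a * a′ ⊗ b * b′

  module Tensor {a ℓ₁ b ℓ₂} (A : Algebra a ℓ₁) (B : Algebra b ℓ₂) where

    private
      module A = Algebra A
      module B = Algebra B

    infixl 6 _⊕_
    infixl 7 _⊗_
    infix  8 ⊖_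
    infix  4 _≈ᵗ_

    data Carrier : Set (a ⊔ b) where
      𝟎   : Carrier
      _⊕_ : Carrier → Carrier → Carrier
      ⊖_  : Carrier → Carrier
      _⊗_ : A.Carrier → B.Carrier → Carrier

    data _≈ᵗ_ : Carrier → Carrier → Set (c ⊔ a ⊔ ℓ₁ ⊔ b ⊔ ℓ₂) where
      refl      : ∀ {t} → t ≈ᵗ t
      sym       : ∀ {t u} → t ≈ᵗ u → u ≈ᵗ t
      trans     : ∀ {t u v} → t ≈ᵗ u → u ≈ᵗ v → t ≈ᵗ v
      ⊕-cong    : ∀ {t t′ u u′} → t ≈ᵗ t′ → u ≈ᵗ u′ → t ⊕ u ≈ᵗ t′ ⊕ u′
      ⊖-cong    : ∀ {t t′} → t ≈ᵗ t′ → ⊖ t ≈ᵗ ⊖ t′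
      ⊕-assoc   : ∀ t u v → (t ⊕ u) ⊕ v ≈ᵗ t ⊕ (u ⊕ v)
      ⊕-comm    : ∀ t u → t ⊕ u ≈ᵗ u ⊕ t
      ⊕-idˡ     : ∀ t → 𝟎 ⊕ t ≈ᵗ t
      ⊖-invˡ    : ∀ t → ⊖ t ⊕ t ≈ᵗ 𝟎
      ⊗-cong    : ∀ {x x′ y y′} → x A.≈ x′ → y B.≈ y′ → x ⊗ y ≈ᵗ x′ ⊗ y′
      ⊗-+ˡ      : ∀ x x′ y → (x A.+ x′) ⊗ y ≈ᵗ x ⊗ y ⊕ x′ ⊗ y
      ⊗-+ʳ      : ∀ x y y′ → x ⊗ (y B.+ y′) ≈ᵗ x ⊗ y ⊕ x ⊗ y′
      ⊗-balance : ∀ k x y → (A.η k A.* x) ⊗ y ≈ᵗ x ⊗ (B.η k B.* y)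

    additive : AbelianGroup (a ⊔ b) (c ⊔ a ⊔ ℓ₁ ⊔ b ⊔ ℓ₂)
    additive = record
      { Carrier = Carrier
      ; _≈_ = _≈ᵗ_
      ; _∙_ = _⊕_
      ; ε = 𝟎
      ; _⁻¹ = ⊖_
      ; isAbelianGroup = record
        { isGroup = record
          { isMonoid = record
            { isSemigroup = record
              { isMagma = record
                { isEquivalence = record { refl = refl ; sym = sym ; trans = trans }
                ; ∙-cong = ⊕-cong
                }
              ; assoc = ⊕-assoc
              }
            ; identity = ⊕-idˡ , λ t → trans (⊕-comm _ _) (⊕-idˡ t)
            }
          ; inverse = ⊖-invˡ , λ t → trans (⊕-comm _ _) (⊖-invˡ t)
          ; ⁻¹-cong = ⊖-cong
          }
        ; comm = ⊕-comm
        }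
      }

    -- The map determined by a bilinear map.

    module Lift {m ℓm} (M : AbelianGroup m ℓm) where

      private
        module M = AbelianGroup M
        module P = AbelianGroupProperties M
        module S = CommutativeSemigroupProperties M.commutativeSemigroup

      record Bilinear (β : A.Carrier → B.Carrier → M.Carrier) : Set (c ⊔ a ⊔ ℓ₁ ⊔ b ⊔ ℓ₂ ⊔ ℓm) where
        field
          cong    : ∀ {x x′ y y′} → x A.≈ x′ → y B.≈ y′ → β x y M.≈ β x′ y′
          +ˡ      : ∀ x x′ y → β (x A.+ x′) y M.≈ β x y M.∙ β x′ y
          +ʳ      : ∀ x y y′ → β x (y B.+ y′) M.≈ β x y M.∙ β x y′
          balance : ∀ k x y → β (A.η k A.* x) y M.≈ β x (B.η k B.* y)

      lift : (A.Carrier → B.Carrier → M.Carrier) → Carrier → M.Carrier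
      lift β 𝟎       = M.ε
      lift β (t ⊕ u) = lift β t M.∙ lift β u
      lift β (⊖ t)   = lift β t M.⁻¹
      lift β (x ⊗ y) = β x y

      lift-cong : ∀ {β} → Bilinear β → ∀ {t u} → t ≈ᵗ u → lift β t M.≈ lift β u
      lift-cong {β} bil = go
        where
        open Bilinear bil
        go : ∀ {t u} → t ≈ᵗ u → lift β t M.≈ lift β u
        go refl              = M.refl
        go (sym e)           = M.sym (go e)
        go (trans e e′)      = M.trans (go e) (go e′)
        go (⊕-cong e e′)     = M.∙-cong (go e) (go e′)
        go (⊖-cong e)        = M.⁻¹-cong (go e)
        go (⊕-assoc t u v)   = M.assoc _ _ _
        go (⊕-comm t u)      = M.comm _ _
        go (⊕-idˡ t)         = M.identityˡ _
        go (⊖-invˡ t)        = M.inverseˡ _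
        go (⊗-cong e e′)     = cong e e′
        go (⊗-+ˡ x x′ y)     = +ˡ x x′ y
        go (⊗-+ʳ x y y′)     = +ʳ x y y′
        go (⊗-balance k x y) = balance k x y

      lift-ext : ∀ {β γ} → (∀ x y → β x y M.≈ γ x y) → ∀ t → lift β t M.≈ lift γ t
      lift-ext e 𝟎       = M.refl
      lift-ext e (t ⊕ u) = M.∙-cong (lift-ext e t) (lift-ext e u)
      lift-ext e (⊖ t)   = M.⁻¹-cong (lift-ext e t)
      lift-ext e (x ⊗ y) = e x y

      lift-∙ : ∀ {β γ δ} → (∀ x y → δ x y M.≈ β x y M.∙ γ x y) →
        ∀ t → lift δ t M.≈ lift β t M.∙ lift γ t
      lift-∙ e 𝟎       = M.sym (M.identityˡ _)
      lift-∙ e (t ⊕ u) = M.trans (M.∙-cong (lift-∙ e t) (lift-∙ e u)) (S.interchange _ _ _ _)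
      lift-∙ e (⊖ t)   = M.trans (M.⁻¹-cong (lift-∙ e t)) (M.sym (P.⁻¹-∙-comm _ _))
      lift-∙ e (x ⊗ y) = e x y

    open Lift additive
    private
      module P = AbelianGroupProperties additive
      module S = CommutativeSemigroupProperties (AbelianGroup.commutativeSemigroup additive)

    infixl 7 _⊛_

    pure-⊛ : A.Carrier → B.Carrier → Carrier → Carrier
    pure-⊛ x y = lift λ x′ y′ → (x A.* x′) ⊗ (y B.* y′)

    _⊛_ : Carrier → Carrier → Carrier
    t ⊛ u = lift (λ x y → pure-⊛ x y u) t

    private
      pure-bilinear : ∀ x y → Bilinear (λ x′ y′ → (x A.* x′) ⊗ (y B.* y′))
      pure-bilinear x y = record
        { cong    = λ e e′ → ⊗-cong (A.*-congˡ e) (B.*-congˡ e′)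
        ; +ˡ      = λ _ _ _ → trans (⊗-cong (A.distribˡ _ _ _) B.refl) (⊗-+ˡ _ _ _)
        ; +ʳ      = λ _ _ _ → trans (⊗-cong A.refl (B.distribˡ _ _ _)) (⊗-+ʳ _ _ _)
        ; balance = λ k x′ y′ →
            trans (⊗-cong (A*.x∙yz≈y∙xz _ _ _) B.refl)
            (trans (⊗-balance k _ _) (⊗-cong A.refl (B*.x∙yz≈y∙xz _ _ _)))
        }
        where
        module A* = CommutativeSemigroupProperties A.*-commutativeSemigroup
        module B* = CommutativeSemigroupProperties B.*-commutativeSemigroup

      ⊛-bilinear : ∀ u → Bilinear (λ x y → pure-⊛ x y u)
      ⊛-bilinear u = record
        { cong    = λ e e′ → lift-ext (λ _ _ → ⊗-cong (A.*-congʳ e) (B.*-congʳ e′)) u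
        ; +ˡ      = λ _ _ _ → lift-∙
            (λ _ _ → trans (⊗-cong (A.distribʳ _ _ _) B.refl) (⊗-+ˡ _ _ _)) u
        ; +ʳ      = λ _ _ _ → lift-∙
            (λ _ _ → trans (⊗-cong A.refl (B.distribʳ _ _ _)) (⊗-+ʳ _ _ _)) u
        ; balance = λ k x y → lift-ext (λ _ _ →
            trans (⊗-cong (A.*-assoc _ _ _) B.refl)
            (trans (⊗-balance k _ _) (⊗-cong A.refl (B.sym (B.*-assoc _ _ _))))) u
        }

      ⊛-congʳ : ∀ u {t t′} → t ≈ᵗ t′ → t ⊛ u ≈ᵗ t′ ⊛ u
      ⊛-congʳ u = lift-cong (⊛-bilinear u)

      ⊛-congˡ : ∀ t {u u′} → u ≈ᵗ u′ → t ⊛ u ≈ᵗ t ⊛ u′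
      ⊛-congˡ t e = lift-ext (λ x y → lift-cong (pure-bilinear x y) e) t

      ⊛-zeroʳ : ∀ t → t ⊛ 𝟎 ≈ᵗ 𝟎
      ⊛-zeroʳ 𝟎       = refl
      ⊛-zeroʳ (t ⊕ u) = trans (⊕-cong (⊛-zeroʳ t) (⊛-zeroʳ u)) (⊕-idˡ _)
      ⊛-zeroʳ (⊖ t)   = trans (⊖-cong (⊛-zeroʳ t)) P.ε⁻¹≈ε
      ⊛-zeroʳ (x ⊗ y) = refl

      ⊛-distribˡ : ∀ t u v → t ⊛ (u ⊕ v) ≈ᵗ t ⊛ u ⊕ t ⊛ v
      ⊛-distribˡ t u v = lift-∙ (λ _ _ → refl) t

      ⊛-⊖ʳ : ∀ t u → t ⊛ (⊖ u) ≈ᵗ ⊖ (t ⊛ u)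
      ⊛-⊖ʳ t u = P.inverseˡ-unique _ _
        (trans (sym (⊛-distribˡ t (⊖ u) u)) (trans (⊛-congˡ t (⊖-invˡ u)) (⊛-zeroʳ t)))

      ⊛-comm : ∀ t u → t ⊛ u ≈ᵗ u ⊛ t
      ⊛-comm 𝟎       u = sym (⊛-zeroʳ u)
      ⊛-comm (t ⊕ v) u = trans (⊕-cong (⊛-comm t u) (⊛-comm v u)) (sym (⊛-distribˡ u t v))
      ⊛-comm (⊖ t)   u = trans (⊖-cong (⊛-comm t u)) (sym (⊛-⊖ʳ u t))
      ⊛-comm (x ⊗ y) u = go u
        where
        go : ∀ u → (x ⊗ y) ⊛ u ≈ᵗ u ⊛ (x ⊗ y)
        go 𝟎         = refl
        go (u ⊕ v)   = ⊕-cong (go u) (go v)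
        go (⊖ u)     = ⊖-cong (go u)
        go (x′ ⊗ y′) = ⊗-cong (A.*-comm _ _) (B.*-comm _ _)

      ⊛-assoc : ∀ t u v → (t ⊛ u) ⊛ v ≈ᵗ t ⊛ (u ⊛ v)
      ⊛-assoc 𝟎       u v = refl
      ⊛-assoc (t ⊕ s) u v = ⊕-cong (⊛-assoc t u v) (⊛-assoc s u v)
      ⊛-assoc (⊖ t)   u v = ⊖-cong (⊛-assoc t u v)
      ⊛-assoc (x ⊗ y) u v = go u
        where
        go′ : ∀ x′ y′ v → ((x ⊗ y) ⊛ (x′ ⊗ y′)) ⊛ v ≈ᵗ (x ⊗ y) ⊛ ((x′ ⊗ y′) ⊛ v)
        go′ x′ y′ 𝟎       = refl
        go′ x′ y′ (v ⊕ w) = ⊕-cong (go′ x′ y′ v) (go′ x′ y′ w)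
        go′ x′ y′ (⊖ v)   = ⊖-cong (go′ x′ y′ v)
        go′ x′ y′ (_ ⊗ _) = ⊗-cong (A.*-assoc _ _ _) (B.*-assoc _ _ _)
        go : ∀ u → ((x ⊗ y) ⊛ u) ⊛ v ≈ᵗ (x ⊗ y) ⊛ (u ⊛ v)
        go 𝟎         = refl
        go (u ⊕ w)   = ⊕-cong (go u) (go w)
        go (⊖ u)     = ⊖-cong (go u)
        go (x′ ⊗ y′) = go′ x′ y′ v

      ⊛-identityˡ : ∀ t → (A.1# ⊗ B.1#) ⊛ t ≈ᵗ t
      ⊛-identityˡ 𝟎       = refl
      ⊛-identityˡ (t ⊕ u) = ⊕-cong (⊛-identityˡ t) (⊛-identityˡ u)
      ⊛-identityˡ (⊖ t)   = ⊖-cong (⊛-identityˡ t)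
      ⊛-identityˡ (x ⊗ y) = ⊗-cong (A.*-identityˡ _) (B.*-identityˡ _)

    ring : CommutativeRing (a ⊔ b) (c ⊔ a ⊔ ℓ₁ ⊔ b ⊔ ℓ₂)
    ring = record
      { Carrier = Carrier
      ; _≈_ = _≈ᵗ_
      ; _+_ = _⊕_
      ; _*_ = _⊛_
      ; -_ = ⊖_
      ; 0# = 𝟎
      ; 1# = A.1# ⊗ B.1#
      ; isCommutativeRing = record
        { isRing = record
          { +-isAbelianGroup = AbelianGroup.isAbelianGroup additive
          ; *-cong = λ {t} {t′} {u} {u′} e e′ → trans (⊛-congʳ u e) (⊛-congˡ t′ e′)
          ; *-assoc = ⊛-assoc
          ; *-identity = ⊛-identityˡ , λ t → trans (⊛-comm t (A.1# ⊗ B.1#)) (⊛-identityˡ t)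
          ; distrib = ⊛-distribˡ , λ _ _ _ → refl
          }
        ; *-comm = ⊛-comm
        }
      }

    algebra : Algebra (a ⊔ b) (c ⊔ a ⊔ ℓ₁ ⊔ b ⊔ ℓ₂)
    algebra = record
      { commutativeRing      = ring
      ; η                    = λ k → A.η k ⊗ B.1#
      ; η-isRingHomomorphism = ringHomomorphism K ring _
          (λ e → ⊗-cong (A.η-cong e) B.refl)
          (λ x y → trans (⊗-cong (A.η-+ x y) B.refl) (⊗-+ˡ _ _ _))
          (λ x y → ⊗-cong (A.η-* x y) (B.sym (B.*-identityˡ _)))
          (⊗-cong A.η-1 B.refl)
      }

  infixl 7 _⊗ᵃ_ _⊗ʰ_

  _⊗ᵃ_ : ∀ {a ℓ₁ b ℓ₂} → Algebra a ℓ₁ → Algebra b ℓ₂ → Algebra (a ⊔ b) (c ⊔ a ⊔ ℓ₁ ⊔ b ⊔ ℓ₂)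
  A ⊗ᵃ B = Tensor.algebra A B

  -- The homomorphism determined by a bilinear map that is multiplicative
  -- and unital on pure tensors.

  module _ {a ℓ₁ b ℓ₂ d ℓ₃} {A : Algebra a ℓ₁} {B : Algebra b ℓ₂} (C : Algebra d ℓ₃) where

    private
      module A = Algebra A
      module B = Algebra B
      module C = Algebra C
      module CP = RingProperties C.ring
      open Tensor A B
      open Lift C.+-abelianGroup

    liftʰ : (β : A.Carrier → B.Carrier → C.Carrier) → Bilinear β →
      (∀ x y x′ y′ → β (x A.* x′) (y B.* y′) C.≈ β x y C.* β x′ y′) →
      (∀ k → β (A.η k) B.1# C.≈ C.η k) → Hom (A ⊗ᵃ B) C
    liftʰ β bil mult unit = record
      { ⟦_⟧                = lift β
      ; isRingHomomorphism = ringHomomorphism (Tensor.ring A B) C.commutativeRing (lift β)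
          (lift-cong bil) (λ _ _ → C.refl) *-homo
          (C.trans (Bilinear.cong bil (A.sym A.η-1) B.refl) (C.trans (unit K.1#) C.η-1))
      ; η-homo             = unit
      }
      where
      pure : ∀ x y u → lift β ((x ⊗ y) ⊛ u) C.≈ β x y C.* lift β u
      pure x y 𝟎         = C.sym (C.zeroʳ _)
      pure x y (u ⊕ v)   = C.trans (C.+-cong (pure x y u) (pure x y v)) (C.sym (C.distribˡ _ _ _))
      pure x y (⊖ u)     = C.trans (C.-‿cong (pure x y u)) (CP.-‿distribʳ-* _ _)
      pure x y (x′ ⊗ y′) = mult x y x′ y′
      *-homo : ∀ t u → lift β (t ⊛ u) C.≈ lift β t C.* lift β u
      *-homo 𝟎       u = C.sym (C.zeroˡ _)
      *-homo (t ⊕ v) u = C.trans (C.+-cong (*-homo t u) (*-homo v u)) (C.sym (C.distribʳ _ _ _))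
      *-homo (⊖ t)   u = C.trans (C.-‿cong (*-homo t u)) (CP.-‿distribˡ-* _ _)
      *-homo (x ⊗ y) u = pure x y u

  _⊗ʰ_ : ∀ {a ℓ₁ b ℓ₂ a′ ℓ₁′ b′ ℓ₂′}
    {A : Algebra a ℓ₁} {B : Algebra b ℓ₂} {A′ : Algebra a′ ℓ₁′} {B′ : Algebra b′ ℓ₂′} →
    Hom A A′ → Hom B B′ → Hom (A ⊗ᵃ B) (A′ ⊗ᵃ B′)
  _⊗ʰ_ {A′ = A′} {B′ = B′} f g = liftʰ (A′ ⊗ᵃ B′) (λ x y → f.⟦ x ⟧ ⊗ g.⟦ y ⟧)
    (record
      { cong    = λ e e′ → ⊗-cong (f.⟦⟧-cong e) (g.⟦⟧-cong e′)
      ; +ˡ      = λ _ _ _ → trans (⊗-cong (f.+-homo _ _) B′.refl) (⊗-+ˡ _ _ _)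
      ; +ʳ      = λ _ _ _ → trans (⊗-cong A′.refl (g.+-homo _ _)) (⊗-+ʳ _ _ _)
      ; balance = λ k _ _ →
          trans (⊗-cong (A′.trans (f.*-homo _ _) (A′.*-congʳ (f.η-homo k))) B′.refl)
          (trans (⊗-balance k _ _)
          (⊗-cong A′.refl (B′.sym (B′.trans (g.*-homo _ _) (B′.*-congʳ (g.η-homo k))))))
      })
    (λ _ _ _ _ → ⊗-cong (f.*-homo _ _) (g.*-homo _ _))
    (λ k → ⊗-cong (f.η-homo k) g.1#-homo)
    where
    module A′ = Algebra A′
    module B′ = Algebra B′
    module f = Hom f renaming (⟦_⟧ to infix 10 ⟦_⟧)
    module g = Hom g renaming (⟦_⟧ to infix 10 ⟦_⟧)
    open Tensor A′ B′

  -- The identification of K ⊗ K with K.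

  K⊗K→K : Hom (base ⊗ᵃ base) base
  K⊗K→K = liftʰ base K._*_
    (record
      { cong    = K.*-cong
      ; +ˡ      = λ _ _ _ → K.distribʳ _ _ _
      ; +ʳ      = λ _ _ _ → K.distribˡ _ _ _
      ; balance = λ k _ _ → K.trans (K.*-congʳ (K.*-comm _ _)) (K.*-assoc _ _ _)
      })
    (λ _ _ _ _ → K*.interchange _ _ _ _)
    K.*-identityʳ
    where
    module K* = CommutativeSemigroupProperties K.*-commutativeSemigroup

  ----------------------------------------------------------------------
  -- The algebra 𝒯 with its comultiplication, and its characters

  record Variable : Set where
    field
      {size}     : ℕ
      .⦃ size≢0 ⦄ : NonZero size
      partition  : NC size
      .proper    : partition ≢ 𝟙

  𝒯 : Algebra c (c ⊔ ℓ)
  𝒯 = polynomials Variable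

  private
    module 𝒯 = Algebra 𝒯
    module 𝒯⊗𝒯 = Algebra (𝒯 ⊗ᵃ 𝒯)
    module ∏𝒯 = BigOperators 𝒯.*-commutativeMonoid
    module ∑𝒯⊗𝒯 = BigOperators 𝒯⊗𝒯.+-commutativeMonoid
    module ∏ = BigOperators K.*-commutativeMonoid
    module ∑ = BigOperators K.+-commutativeMonoid
    open Tensor 𝒯 𝒯 using (_⊗_)

  X : .⦃ NonZero n ⦄ → NC n → 𝒯.Carrier
  X π with π ≟ 𝟙
  ... | yes _  = 𝒯.1#
  ... | no π≢𝟙 = var (record { partition = π ; proper = π≢𝟙 })

  ΔX : .⦃ NonZero n ⦄ → NC n → 𝒯⊗𝒯.Carrier
  ΔX {n} π = ∑𝒯⊗𝒯.⨁ (allNC n) λ σ → ∑𝒯⊗𝒯.when (π ≼? σ) λ _ →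
    ∏𝒯.overBlocks σ (λ W → X (π ↾ W)) ⊗ X σ

  Δ : Hom 𝒯 (𝒯 ⊗ᵃ 𝒯)
  Δ = extend (𝒯 ⊗ᵃ 𝒯) λ { record { size≢0 = m≢0 ; partition = π } → ΔX ⦃ m≢0 ⦄ π }

  Character : Set (c ⊔ ℓ)
  Character = Hom 𝒯 base

  𝕏 : RawMagma (c ⊔ ℓ) (c ⊔ ℓ)
  𝕏 = record
    { Carrier = Character
    ; _≈_     = λ χ χ′ → ∀ p → Hom.⟦_⟧ χ p K.≈ Hom.⟦_⟧ χ′ p
    ; _∙_     = λ χ₁ χ₂ → K⊗K→K ∘ʰ (χ₁ ⊗ʰ χ₂) ∘ʰ Δ
    }

  ----------------------------------------------------------------------
  -- Multiplicative functions on {(π , σ) ∣ π ≼ σ} and their convolution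

  NC²-Function : Set c
  NC²-Function = ∀ {n} → .⦃ NonZero n ⦄ → (π σ : NC n) → .(π ≼ σ) → K.Carrier

  record Multiplicative : Set (c ⊔ ℓ) where
    field
      fun      : NC²-Function
      diagonal : ∀ {n} → .⦃ _ : NonZero n ⦄ → (π : NC n) → fun π π (≼-refl π) K.≈ K.1#
      factor   : ∀ {n} → .⦃ _ : NonZero n ⦄ → (π σ : NC n) .(π≼σ : π ≼ σ) →
        fun π σ π≼σ K.≈ ∏.overBlocks σ λ W → fun (π ↾ W) 𝟙 (≼-𝟙 (π ↾ W))

  convolve : NC²-Function → NC²-Function → NC²-Function
  convolve f g {n} π σ _ = ∑.⨁ (allNC n) λ ρ →
    ∑.when (π ≼? ρ) λ π≼ρ → ∑.when (ρ ≼? σ) λ ρ≼σ → f π ρ π≼ρ K.* g ρ σ ρ≼σ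

  -- The convolution of multiplicative functions is multiplicative.

  private

    open import Relation.Binary.Reasoning.Setoid K.setoid

    *-⨁ : ∀ {x} {A : Set x} k (xs : List A) (f : A → K.Carrier) →
      ∑.⨁ xs (λ x → k K.* f x) K.≈ k K.* ∑.⨁ xs f
    *-⨁ k []       f = K.sym (K.zeroʳ k)
    *-⨁ k (x ∷ xs) f = K.trans (K.+-congˡ (*-⨁ k xs f)) (K.sym (K.distribˡ _ _ _))

    ⨁-* : ∀ {x} {A : Set x} k (xs : List A) (f : A → K.Carrier) →
      ∑.⨁ xs (λ x → f x K.* k) K.≈ ∑.⨁ xs f K.* k
    ⨁-* k xs f = K.trans (∑.⨁-cong xs λ _ → K.*-comm _ _) (K.trans (*-⨁ k xs f) (K.*-comm _ _))

    ∏-zero : ∀ {n} (f : Fin n → K.Carrier) i → f i K.≈ K.0# → ∏.sum f K.≈ K.0#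
    ∏-zero f Fin.zero    e = K.trans (K.*-congʳ e) (K.zeroˡ _)
    ∏-zero f (Fin.suc i) e = K.trans (K.*-congˡ (∏-zero (f ∘ Fin.suc) i e)) (K.zeroʳ _)

    -- The sum over all families with τ i in the list L i.

    ΣΠ : ∀ n {A : Fin n → Set} → (∀ i → List (A i)) → ((∀ i → A i) → K.Carrier) → K.Carrier
    ΣΠ ℕ.zero    L G = G λ ()
    ΣΠ (ℕ.suc n) L G = ∑.⨁ (L Fin.zero) λ x → ΣΠ n (L ∘ Fin.suc) λ τ → G (Fin.∀-cons x τ)

    ΣΠ-cong : ∀ n {A : Fin n → Set} (L : ∀ i → List (A i)) {G H} →
      (∀ τ → G τ K.≈ H τ) → ΣΠ n L G K.≈ ΣΠ n L H
    ΣΠ-cong ℕ.zero    L e = e _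
    ΣΠ-cong (ℕ.suc n) L e = ∑.⨁-cong (L Fin.zero) λ x → ΣΠ-cong n (L ∘ Fin.suc) λ τ → e _

    ΣΠ-0 : ∀ n {A : Fin n → Set} (L : ∀ i → List (A i)) → ΣΠ n L (λ _ → K.0#) K.≈ K.0#
    ΣΠ-0 ℕ.zero    L = K.refl
    ΣΠ-0 (ℕ.suc n) L = ∑.⨁-ε (L Fin.zero) λ x → ΣΠ-0 n (L ∘ Fin.suc)

    ΣΠ-+ : ∀ n {A : Fin n → Set} (L : ∀ i → List (A i)) G H →
      ΣΠ n L (λ τ → G τ K.+ H τ) K.≈ ΣΠ n L G K.+ ΣΠ n L H
    ΣΠ-+ ℕ.zero    L G H = K.refl
    ΣΠ-+ (ℕ.suc n) L G H = K.trans
      (∑.⨁-cong (L Fin.zero) λ x → ΣΠ-+ n (L ∘ Fin.suc) _ _) (∑.⨁-∙ (L Fin.zero) _ _)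

    ΣΠ-* : ∀ n {A : Fin n → Set} (L : ∀ i → List (A i)) k G →
      ΣΠ n L (λ τ → k K.* G τ) K.≈ k K.* ΣΠ n L G
    ΣΠ-* ℕ.zero    L k G = K.refl
    ΣΠ-* (ℕ.suc n) L k G = K.trans
      (∑.⨁-cong (L Fin.zero) λ x → ΣΠ-* n (L ∘ Fin.suc) k _) (*-⨁ k (L Fin.zero) _)

    ΣΠ-⨁ : ∀ n {A : Fin n → Set} (L : ∀ i → List (A i)) {x} {B : Set x} (ys : List B)
      (G : B → (∀ i → A i) → K.Carrier) →
      ΣΠ n L (λ τ → ∑.⨁ ys λ y → G y τ) K.≈ ∑.⨁ ys λ y → ΣΠ n L (G y)
    ΣΠ-⨁ n L []       G = ΣΠ-0 n L
    ΣΠ-⨁ n L (y ∷ ys) G = K.trans (ΣΠ-+ n L _ _) (K.+-congˡ (ΣΠ-⨁ n L ys G))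

    ΣΠ-∏ : ∀ n {A : Fin n → Set} (L : ∀ i → List (A i)) (h : ∀ i → A i → K.Carrier) →
      ΣΠ n L (λ τ → ∏.sum λ i → h i (τ i)) K.≈ ∏.sum λ i → ∑.⨁ (L i) (h i)
    ΣΠ-∏ ℕ.zero    L h = K.refl
    ΣΠ-∏ (ℕ.suc n) L h = begin
      ∑.⨁ (L Fin.zero) (λ x → ΣΠ n (L ∘ Fin.suc) λ τ → h Fin.zero x K.* _)
        ≈⟨ ∑.⨁-cong (L Fin.zero) (λ x → ΣΠ-* n (L ∘ Fin.suc) (h Fin.zero x) _) ⟩
      ∑.⨁ (L Fin.zero) (λ x → h Fin.zero x K.* ΣΠ n (L ∘ Fin.suc) (λ τ → ∏.sum λ i → h (Fin.suc i) (τ i)))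
        ≈⟨ ⨁-* _ (L Fin.zero) (h Fin.zero) ⟩
      ∑.⨁ (L Fin.zero) (h Fin.zero) K.* ΣΠ n (L ∘ Fin.suc) (λ τ → ∏.sum λ i → h (Fin.suc i) (τ i))
        ≈⟨ K.*-congˡ (ΣΠ-∏ n (L ∘ Fin.suc) (λ i → h (Fin.suc i))) ⟩
      ∑.⨁ (L Fin.zero) (h Fin.zero) K.* ∏.sum (λ i → ∑.⨁ (L (Fin.suc i)) (h (Fin.suc i))) ∎

    ∑-when-* : ∀ {p} {P : Set p} (P? : Dec P) k l →
      ∑.when P? (λ _ → k) K.* l K.≈ ∑.when P? (λ _ → k K.* l)
    ∑-when-* (yes _) k l = K.refl
    ∑-when-* (no _)  k l = K.zeroˡ l

    -- The product over the blocks W of σ of sums over NC ∣ W ∣ is a sum over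
    -- the partitions below σ.

    module Exchange (σ : NC n) (F : ∀ i → NC ∣ block σ i ∣ → K.Carrier) where

      A : Fin n → Set
      A i = NC ∣ block σ i ∣

      list : ∀ {i} → Dec (Leader σ i) → List (A i)
      list (yes _) = allNC _
      list (no _)  = 𝟙 ∷ []

      L : ∀ i → List (A i)
      L i = list (leader? σ i)

      G : ∀ i → A i → K.Carrier
      G i τ = ∏.when (leader? σ i) λ _ → F i τ

      D : NC n → ∀ i → A i → K.Carrier
      D ρ i τ = ∏.when (leader? σ i) λ _ → ∑.when (ρ ↾ block σ i ≟ τ) λ _ → K.1#

      sum-G : ∀ i → ∑.⨁ (L i) (G i) K.≈ ∏.when (leader? σ i) λ _ → ∑.⨁ (allNC _) (F i)
      sum-G i with leader? σ i
      ... | yes _ = K.refl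
      ... | no _  = K.+-identityʳ _

      sum-D : ∀ ρ i → ∑.⨁ (L i) (D ρ i) K.≈ K.1#
      sum-D ρ i with leader? σ i
      ... | yes _ = K.trans
        (∑.enum-NC _ _ (ρ ↾ block σ i) λ τ τ≢ → ∑.when-no (ρ ↾ block σ i ≟ τ) (τ≢ ∘ ≡.sym))
        (∑.when-yes (ρ ↾ block σ i ≟ ρ ↾ block σ i) ≡.refl)
      ... | no _  = K.+-identityʳ _

      restricted : NC n → K.Carrier
      restricted ρ = ∏.sum λ i → G i (ρ ↾ block σ i)

      term : (∀ i → A i) → NC n → K.Carrier
      term τ ρ = ∑.when (ρ ≼? σ) λ _ → (∏.sum λ i → D ρ i (τ i)) K.* restricted ρ

      family : ∀ τ → ∏.sum (λ i → G i (τ i)) K.≈ ∑.⨁ (allNC n) (term τ)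
      family τ = K.sym (K.trans (∑.enum-NC n (term τ) ρ₀ others) this)
        where
        ρ₀ : NC n
        ρ₀ = glue σ τ

        this : term τ ρ₀ K.≈ ∏.sum (λ i → G i (τ i))
        this = K.trans (∑.when-yes (ρ₀ ≼? σ) (glue-≼ σ τ)) (K.trans
          (K.*-cong
            (∏.sum-ε _ λ i → K.trans
              (∏.when-cong (leader? σ i) λ li → ∑.when-yes (ρ₀ ↾ block σ i ≟ τ i) (glue-↾ σ τ i li))
              (∏.when-ε (leader? σ i)))
            (∏.sum-cong λ i → ∏.when-cong (leader? σ i) λ li →
              K.reflexive (≡.cong (F i) (glue-↾ σ τ i li))))
          (K.*-identityˡ _))

        others : ∀ ρ → ρ ≢ ρ₀ → term τ ρ K.≈ K.0#
        others ρ ρ≢ = K.trans (∑.when-cong (ρ ≼? σ) vanish) (∑.when-ε (ρ ≼? σ))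
          where
          vanish : ρ ≼ σ → (∏.sum λ i → D ρ i (τ i)) K.* restricted ρ K.≈ K.0#
          vanish ρ≼σ = vanish′ (Fin.¬∀⟶∃¬ n Agree (λ i → leader? σ i →-dec (ρ ↾ block σ i ≟ τ i))
            λ h → ρ≢ (≡-from-↾ ρ ρ₀ σ ρ≼σ (glue-≼ σ τ) λ w lw →
              ≡.trans (h w lw) (≡.sym (glue-↾ σ τ w lw))))
            where
            Agree : Fin n → Set
            Agree i = Leader σ i → ρ ↾ block σ i ≡ τ i

            D-zero : ∀ i (l : Dec (Leader σ i)) (e : Dec (ρ ↾ block σ i ≡ τ i)) → ¬ Agree i →
              ∏.when l (λ _ → ∑.when e λ _ → K.1#) K.≈ K.0#
            D-zero i (yes _) (yes e) ¬h = contradiction (λ _ → e) ¬h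
            D-zero i (yes _) (no _)  ¬h = K.refl
            D-zero i (no ¬l) _       ¬h = contradiction (λ l → contradiction l ¬l) ¬h

            vanish′ : (∃ λ i → ¬ Agree i) → (∏.sum λ i → D ρ i (τ i)) K.* restricted ρ K.≈ K.0#
            vanish′ (i , ¬h) = K.trans
              (K.*-congʳ (∏-zero (λ i → D ρ i (τ i)) i
                (D-zero i (leader? σ i) (ρ ↾ block σ i ≟ τ i) ¬h)))
              (K.zeroˡ (restricted ρ))

      exchange :
        ∑.⨁ (allNC n) (λ ρ → ∑.when (ρ ≼? σ) λ _ → restricted ρ) K.≈
        ∏.sum (λ i → ∏.when (leader? σ i) λ _ → ∑.⨁ (allNC _) (F i))
      exchange = K.sym (begin
        ∏.sum (λ i → ∏.when (leader? σ i) λ _ → ∑.⨁ (allNC _) (F i))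
          ≈⟨ ∏.sum-cong sum-G ⟨
        ∏.sum (λ i → ∑.⨁ (L i) (G i))
          ≈⟨ ΣΠ-∏ n L G ⟨
        ΣΠ n L (λ τ → ∏.sum λ i → G i (τ i))
          ≈⟨ ΣΠ-cong n L family ⟩
        ΣΠ n L (λ τ → ∑.⨁ (allNC n) (term τ))
          ≈⟨ ΣΠ-⨁ n L (allNC n) (λ ρ τ → term τ ρ) ⟩
        ∑.⨁ (allNC n) (λ ρ → ΣΠ n L (λ τ → term τ ρ))
          ≈⟨ ∑.⨁-cong (allNC n) (λ ρ → collect ρ (ρ ≼? σ)) ⟩
        ∑.⨁ (allNC n) (λ ρ → ∑.when (ρ ≼? σ) λ _ → restricted ρ) ∎)
        where
        collect : ∀ ρ (d : Dec (ρ ≼ σ)) →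
          ΣΠ n L (λ τ → ∑.when d λ _ → (∏.sum λ i → D ρ i (τ i)) K.* restricted ρ) K.≈
          ∑.when d λ _ → restricted ρ
        collect ρ (no _)  = ΣΠ-0 n L
        collect ρ (yes _) = begin
          ΣΠ n L (λ τ → (∏.sum λ i → D ρ i (τ i)) K.* restricted ρ)
            ≈⟨ ΣΠ-cong n L (λ _ → K.*-comm _ _) ⟩
          ΣΠ n L (λ τ → restricted ρ K.* (∏.sum λ i → D ρ i (τ i)))
            ≈⟨ ΣΠ-* n L (restricted ρ) _ ⟩
          restricted ρ K.* ΣΠ n L (λ τ → ∏.sum λ i → D ρ i (τ i))
            ≈⟨ K.*-congˡ (ΣΠ-∏ n L (D ρ)) ⟩
          restricted ρ K.* ∏.sum (λ i → ∑.⨁ (L i) (D ρ i))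
            ≈⟨ K.*-congˡ (∏.sum-ε _ (sum-D ρ)) ⟩
          restricted ρ K.* K.1#
            ≈⟨ K.*-identityʳ _ ⟩
          restricted ρ ∎

    module Closed (f g : Multiplicative) where

      module f = Multiplicative f
      module g = Multiplicative g

      diagonal : .⦃ _ : NonZero n ⦄ → (π : NC n) →
        convolve f.fun g.fun π π (≼-refl π) K.≈ K.1#
      diagonal {n} π = begin
        ∑.⨁ (allNC n) term
          ≈⟨ ∑.enum-NC n term π others ⟩
        term π
          ≈⟨ ∑.when-yes (π ≼? π) (≼-refl π) ⟩
        ∑.when (π ≼? π) (λ p → f.fun π π (≼-refl π) K.* g.fun π π p)
          ≈⟨ ∑.when-yes (π ≼? π) (≼-refl π) ⟩
        f.fun π π (≼-refl π) K.* g.fun π π (≼-refl π)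
          ≈⟨ K.*-cong (f.diagonal π) (g.diagonal π) ⟩
        K.1# K.* K.1#
          ≈⟨ K.*-identityˡ _ ⟩
        K.1# ∎
        where
        term : NC n → K.Carrier
        term ρ = ∑.when (π ≼? ρ) λ p → ∑.when (ρ ≼? π) λ q → f.fun π ρ p K.* g.fun ρ π q

        others : ∀ ρ → ρ ≢ π → term ρ K.≈ K.0#
        others ρ ρ≢π = K.trans (∑.when-cong (π ≼? ρ) λ p →
          ∑.when-no (ρ ≼? π) λ q → ρ≢π (≼-antisym {π = ρ} {π} q p)) (∑.when-ε (π ≼? ρ))

      -- f (π , ρ) is the product over W in σ of f (π ↾ W , ρ ↾ W).

      split : .⦃ _ : NonZero n ⦄ → (π ρ σ : NC n) (π≼ρ : π ≼ ρ) → ρ ≼ σ →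
        f.fun π ρ π≼ρ K.≈
        ∏.overBlocks σ λ W → f.fun (π ↾ W) (ρ ↾ W) (≼-↾ π ρ W π≼ρ)
      split {n} π ρ σ π≼ρ ρ≼σ = begin
        f.fun π ρ π≼ρ
          ≈⟨ f.factor π ρ π≼ρ ⟩
        ∏.sum Φ
          ≈⟨ ∏.sum-by-blocks σ Φ ⟨
        ∏.sum (λ i → ∏.when (leader? σ i) λ _ → ∏.sum (Φ ∘ embed (block σ i)))
          ≈⟨ ∏.sum-cong (λ i → ∏.when-cong (leader? σ i) λ _ → K.sym (inner i)) ⟩
        ∏.overBlocks σ (λ W → f.fun (π ↾ W) (ρ ↾ W) (≼-↾ π ρ W π≼ρ)) ∎
        where
        top : ∀ {m} → .⦃ NonZero m ⦄ → NC m → K.Carrier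
        top τ = f.fun τ 𝟙 (≼-𝟙 τ)

        Φ : Fin n → K.Carrier
        Φ j = ∏.when (leader? ρ j) λ _ → top ⦃ ∈⇒nonZero (own ρ j) ⦄ (π ↾ block ρ j)

        top-≡ : ∀ {m m′} .(p : NonZero m) .(q : NonZero m′) {τ : NC m} {τ′ : NC m′} →
          _≡_ {A = Σ ℕ NC} (m , τ) (m′ , τ′) → top ⦃ p ⦄ τ ≡ top ⦃ q ⦄ τ′
        top-≡ p q ≡.refl = ≡.refl

        inner : ∀ i → let W = block σ i in
          f.fun ⦃ ∈⇒nonZero (own σ i) ⦄ (π ↾ W) (ρ ↾ W) (≼-↾ π ρ W π≼ρ) K.≈ ∏.sum (Φ ∘ embed W)
        inner i = K.trans
          (f.factor ⦃ ∈⇒nonZero (own σ i) ⦄ (π ↾ W) (ρ ↾ W) (≼-↾ π ρ W π≼ρ))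
          (∏.sum-cong λ k → same k (leader? (ρ ↾ W) k) (leader? ρ (embed W k)))
          where
          W = block σ i

          sub : ∀ k → block ρ (embed W k) ⊆ W
          sub k j∈ = block-trans σ (embed-∈ W k) (≼⇒ {π = ρ} {σ} ρ≼σ j∈)

          same : ∀ k (d : Dec (Leader (ρ ↾ W) k)) (d′ : Dec (Leader ρ (embed W k))) →
            ∏.when d (λ _ → top ⦃ ∈⇒nonZero (own (ρ ↾ W) k) ⦄ (π ↾ W ↾ block (ρ ↾ W) k)) K.≈
            ∏.when d′ (λ _ → top ⦃ ∈⇒nonZero (own ρ (embed W k)) ⦄ (π ↾ block ρ (embed W k)))
          same k (yes l) (no ¬l) = contradiction (leader-↾⁻ ρ W k (sub k) l) ¬l
          same k (no ¬l) (yes l) = contradiction (leader-↾⁺ ρ W k l) ¬l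
          same k (no _)  (no _)  = K.refl
          same k (yes _) (yes _) = K.reflexive (top-≡
            (∈⇒nonZero (own (ρ ↾ W) k)) (∈⇒nonZero (own ρ (embed W k)))
            (≡.trans (≡.cong (λ V → ∣ V ∣ , π ↾ W ↾ V) (block-↾ ρ W k))
                     (↾-↾ π W (block ρ (embed W k)) (sub k))))

      factor : .⦃ _ : NonZero n ⦄ → (π σ : NC n) .(π≼σ : π ≼ σ) →
        convolve f.fun g.fun π σ π≼σ K.≈
        ∏.overBlocks σ λ W → convolve f.fun g.fun (π ↾ W) 𝟙 (≼-𝟙 (π ↾ W))
      factor {n} π σ π≼σ′ = K.trans
        (∑.⨁-cong (allNC n) λ ρ → term ρ (π ≼? ρ) (ρ ≼? σ))
        exchange
        where
        π≼σ : π ≼ σ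
        π≼σ = recompute (π ≼? σ) π≼σ′

        F : ∀ i → NC ∣ block σ i ∣ → K.Carrier
        F i τ = ∑.when (π ↾ block σ i ≼? τ) λ p → ∑.when (τ ≼? 𝟙) λ q →
          f.fun ⦃ ∈⇒nonZero (own σ i) ⦄ (π ↾ block σ i) τ p K.*
          g.fun ⦃ ∈⇒nonZero (own σ i) ⦄ τ 𝟙 q

        open Exchange σ F using (G; restricted; exchange)

        F-yes : ∀ ρ i → (p : π ↾ block σ i ≼ ρ ↾ block σ i) → F i (ρ ↾ block σ i) K.≈
          f.fun ⦃ ∈⇒nonZero (own σ i) ⦄ (π ↾ block σ i) (ρ ↾ block σ i) p K.*
          g.fun ⦃ ∈⇒nonZero (own σ i) ⦄ (ρ ↾ block σ i) 𝟙 (≼-𝟙 (ρ ↾ block σ i))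
        F-yes ρ i p = K.trans (∑.when-yes (π ↾ block σ i ≼? ρ ↾ block σ i) p)
          (∑.when-yes (ρ ↾ block σ i ≼? 𝟙) (≼-𝟙 (ρ ↾ block σ i)))

        term : ∀ ρ (d : Dec (π ≼ ρ)) (e : Dec (ρ ≼ σ)) →
          ∑.when d (λ p → ∑.when e λ q → f.fun π ρ p K.* g.fun ρ σ q) K.≈
          ∑.when e (λ _ → restricted ρ)
        term ρ d         (no _)    = ∑.when-ε d
        term ρ (yes π≼ρ) (yes ρ≼σ) = begin
          f.fun π ρ π≼ρ K.* g.fun ρ σ ρ≼σ
            ≈⟨ K.*-cong (split π ρ σ π≼ρ ρ≼σ) (g.factor ρ σ ρ≼σ) ⟩
          ∏.sum φ K.* ∏.sum γ
            ≈⟨ FinSum.∑-distrib-+ K.*-commutativeMonoid φ γ ⟨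
          ∏.sum (λ i → φ i K.* γ i)
            ≈⟨ ∏.sum-cong (λ i → merge i (leader? σ i)) ⟩
          restricted ρ ∎
          where
          fᵂ gᵂ : Fin n → K.Carrier
          fᵂ i = f.fun ⦃ ∈⇒nonZero (own σ i) ⦄ (π ↾ block σ i) (ρ ↾ block σ i) (≼-↾ π ρ (block σ i) π≼ρ)
          gᵂ i = g.fun ⦃ ∈⇒nonZero (own σ i) ⦄ (ρ ↾ block σ i) 𝟙 (≼-𝟙 (ρ ↾ block σ i))

          φ γ : Fin n → K.Carrier
          φ i = ∏.when (leader? σ i) λ _ → fᵂ i
          γ i = ∏.when (leader? σ i) λ _ → gᵂ i

          merge : ∀ i (d : Dec (Leader σ i)) →
            ∏.when d (λ _ → fᵂ i) K.* ∏.when d (λ _ → gᵂ i) K.≈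
            ∏.when d (λ _ → F i (ρ ↾ block σ i))
          merge i (yes _) = K.sym (F-yes ρ i (≼-↾ π ρ (block σ i) π≼ρ))
          merge i (no _)  = K.*-identityˡ _
        term ρ (no π⋠ρ)  (yes ρ≼σ) = K.sym (vanish (Fin.¬∀⟶∃¬ n Below
          (λ i → leader? σ i →-dec (π ↾ block σ i ≼? ρ ↾ block σ i)) (π⋠ρ ∘ ≼-from-↾ π ρ σ π≼σ)))
          where
          Below : Fin n → Set
          Below i = Leader σ i → π ↾ block σ i ≼ ρ ↾ block σ i

          F-zero : ∀ i (d : Dec (Leader σ i)) → ¬ Below i →
            ∏.when d (λ _ → F i (ρ ↾ block σ i)) K.≈ K.0#
          F-zero i (yes _) ¬h = ∑.when-no (π ↾ block σ i ≼? ρ ↾ block σ i) λ p → ¬h λ _ → p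
          F-zero i (no ¬l) ¬h = contradiction (λ l → contradiction l ¬l) ¬h

          vanish : (∃ λ i → ¬ Below i) → restricted ρ K.≈ K.0#
          vanish (i , ¬h) = ∏-zero (λ i → G i (ρ ↾ block σ i)) i (F-zero i (leader? σ i) ¬h)

  𝒢 : RawMagma (c ⊔ ℓ) ℓ
  𝒢 = record
    { Carrier = Multiplicative
    ; _≈_     = λ g h → ∀ {n} → .⦃ _ : NonZero n ⦄ → (π σ : NC n) .(π≼σ : π ≼ σ) →
        fun g π σ π≼σ K.≈ fun h π σ π≼σ
    ; _∙_     = λ f g → record
      { fun      = convolve (fun f) (fun g)
      ; diagonal = Closed.diagonal f g
      ; factor   = Closed.factor f g
      }
    }
    where open Multiplicative

{-# OPTIONS --safe #-}
-- 𝒯 is freely generated by the X π with π ≢ 𝟙, so a character is the same as a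
-- choice of values on them.  A multiplicative function is likewise determined by
-- its values g (π , 𝟙), which are arbitrary apart from g (𝟙 , 𝟙) = 1, and
-- evaluating χ₁ ⊗ χ₂ on ΔX π gives the defining sum of the convolution at (π , 𝟙).
module Submission where

open import Defs
open import Level using (Level)
open import Algebra.Bundles using (CommutativeMonoid; CommutativeRing; RawMagma)
open import Algebra.Morphism.Structures using (module MagmaMorphisms)
open import Data.Nat using (ℕ; NonZero; z≤n)
open import Data.Product using (Σ; ∃!; proj₁; _,_)
open import Data.Fin using (Fin; zero; suc; cast)
open import Data.Fin.Properties using (cast-is-id)
open import Data.Fin.Subset using (Subset; inside; outside; _∈_; ∣_∣)
open import Data.Fin.Subset.Properties using (drop-there)
open import Data.List using (List; []; _∷_)
open import Data.Vec using ([]; _∷_; here)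
open import Function using (_∘_)
import Relation.Binary.Reasoning.Setoid as SetoidReasoning
open import Relation.Binary.PropositionalEquality as ≡ using (_≡_)
open import Relation.Nullary using (Dec; yes; no; contradiction; contradiction-irr)

private
  variable
    n : ℕ

-- Restriction to a block of the partition itself and to the full set.

↾-self : (π : NC n) → ∀ i → π ↾ block π i ≡ 𝟙
↾-self π i = NC-ext
  (λ {j} {k} _ → ∈-𝟙 j k)
  (λ {j} {k} _ → ∈-↾⁺ π W (block-trans π (block-sym π (embed-∈ W j)) (embed-∈ W k)))
  where W = block π i

embed-full : (W : Subset n) → (∀ i → i ∈ W) →
  Σ (∣ W ∣ ≡ n) λ eq → ∀ k → embed W k ≡ cast eq k
embed-full []            full = ≡.refl , λ ()
embed-full (inside  ∷ W) full with embed-full W (λ i → drop-there (full (suc i)))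
... | eq , e = ≡.cong ℕ.suc eq , λ where
  zero    → ≡.refl
  (suc k) → ≡.cong suc (e k)
embed-full (outside ∷ W) full with () ← full zero

-- The inclusion of a full subset is the identity up to `cast`. As `∣ W ∣` and `n` agree only
-- propositionally, the equation is stated in `Σ ℕ NC`.
↾-full : (π : NC n) (W : Subset n) → (∀ i → i ∈ W) →
  _≡_ {A = Σ ℕ NC} (∣ W ∣ , π ↾ W) (n , π)
↾-full {n} π W full with embed-full W full
... | eq , e = go eq e (π ↾ W) (∈-↾⁻ π W) (∈-↾⁺ π W)
  where
  -- Replacing `∣ W ∣` by a variable `m` allows matching the equation with `refl`.
  go : ∀ {m} {f : Fin m → Fin n} (eq : m ≡ n) → (∀ k → f k ≡ cast eq k) → (ρ : NC m) →
    (∀ {i j} → j ∈ block ρ i → f j ∈ block π (f i)) →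
    (∀ {i j} → f j ∈ block π (f i) → j ∈ block ρ i) →
    _≡_ {A = Σ ℕ NC} (m , ρ) (n , π)
  go {f = f} ≡.refl e ρ to from = ≡.cong (n ,_) (NC-ext
    (λ {i} {j} j∈ → ≡.subst₂ (λ x y → x ∈ block π y) (e′ j) (e′ i) (to j∈))
    (λ {i} {j} j∈ → from (≡.subst₂ (λ x y → x ∈ block π y) (≡.sym (e′ j)) (≡.sym (e′ i)) j∈)))
    where
    e′ : ∀ k → f k ≡ k
    e′ k = ≡.trans (e k) (cast-is-id ≡.refl k)

-- Products over the blocks of a partition.

module _ {a ℓ} (M : CommutativeMonoid a ℓ) where

  private
    module M = CommutativeMonoid M
  open BigOperators M

  overBlocks-cong : (σ : NC n) (F G : (W : Subset n) → .⦃ NonZero ∣ W ∣ ⦄ → M.Carrier) →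
    (∀ i → F (block σ i) ⦃ ∈⇒nonZero (own σ i) ⦄ M.≈ G (block σ i) ⦃ ∈⇒nonZero (own σ i) ⦄) →
    overBlocks σ F M.≈ overBlocks σ G
  overBlocks-cong σ F G e = sum-cong λ i → when-cong (leader? σ i)
    {λ _ → F (block σ i) ⦃ ∈⇒nonZero (own σ i) ⦄} {λ _ → G (block σ i) ⦃ ∈⇒nonZero (own σ i) ⦄}
    λ _ → e i

  -- `zero` lies in every block of `𝟙`, so it is the only leader. One factor survives, and its block
  -- is the full set.
  overBlocks-𝟙 : (F : ∀ {m} → .⦃ NonZero m ⦄ → NC m → M.Carrier) → .⦃ _ : NonZero n ⦄ →
    (π : NC n) → overBlocks 𝟙 (λ W → F (π ↾ W)) M.≈ F π
  overBlocks-𝟙 {ℕ.zero}  F ⦃ () ⦄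
  overBlocks-𝟙 {ℕ.suc n} F π = M.trans
    (sum-single term zero λ
      { zero    0≢0 → contradiction ≡.refl 0≢0
      ; (suc i) _   → when-no (leader? 𝟙 (suc i)) {value (suc i)}
          λ l → contradiction (l zero (∈-𝟙 (suc i) zero)) λ () })
    (M.trans (when-yes (leader? 𝟙 zero) {value zero} λ _ _ → z≤n)
      (M.reflexive (F-≡ (∈⇒nonZero (own (𝟙 {ℕ.suc n}) zero)) _ (↾-full π (block 𝟙 zero) (∈-𝟙 zero)))))
    where
    value : ∀ (i : Fin (ℕ.suc n)) → .(Leader 𝟙 i) → M.Carrier
    value i _ = F ⦃ ∈⇒nonZero (own 𝟙 i) ⦄ (π ↾ block 𝟙 i)

    term : Fin (ℕ.suc n) → M.Carrier
    term i = when (leader? 𝟙 i) (value i)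

    F-≡ : ∀ {m m′} .(p : NonZero m) .(q : NonZero m′) {τ : NC m} {τ′ : NC m′} →
      _≡_ {A = Σ ℕ NC} (m , τ) (m′ , τ′) → F ⦃ p ⦄ τ ≡ F ⦃ q ⦄ τ′
    F-≡ p q ≡.refl = ≡.refl

module _ {c ℓ} (K : CommutativeRing c ℓ) where

  private
    module K = CommutativeRing K
    module ∏ = BigOperators K.*-commutativeMonoid
    module ∑ = BigOperators K.+-commutativeMonoid
    module 𝒯 = Algebra (𝒯 K)
    module 𝕏 = RawMagma (𝕏 K)
    module 𝒢 = RawMagma (𝒢 K)
    open Multiplicative using (fun; diagonal; factor)
    open Hom using (⟦_⟧; ⟦⟧-cong; 1#-homo)

  -- Algebra homomorphisms commute with finite sums and products.

  module _ {a ℓ₁ b ℓ₂} {A : Algebra K a ℓ₁} {B : Algebra K b ℓ₂} (h : Hom K A B) where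

    private
      module A = Algebra A
      module B = Algebra B
      module h = Hom h
      module ∑ᴬ = BigOperators A.+-commutativeMonoid
      module ∑ᴮ = BigOperators B.+-commutativeMonoid
      module ∏ᴬ = BigOperators A.*-commutativeMonoid
      module ∏ᴮ = BigOperators B.*-commutativeMonoid

    ⟦⨁⟧ : ∀ {x} {Y : Set x} (ys : List Y) (f : Y → A.Carrier) →
      h.⟦ ∑ᴬ.⨁ ys f ⟧ B.≈ ∑ᴮ.⨁ ys λ y → h.⟦ f y ⟧
    ⟦⨁⟧ []       f = h.0#-homo
    ⟦⨁⟧ (y ∷ ys) f = B.trans (h.+-homo _ _) (B.+-congˡ (⟦⨁⟧ ys f))

    ⟦∑-when⟧ : ∀ {p} {P : Set p} (P? : Dec P) {f : .P → A.Carrier} →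
      h.⟦ ∑ᴬ.when P? f ⟧ B.≈ ∑ᴮ.when P? λ p → h.⟦ f p ⟧
    ⟦∑-when⟧ (yes _) = B.refl
    ⟦∑-when⟧ (no _)  = h.0#-homo

    ⟦∏-when⟧ : ∀ {p} {P : Set p} (P? : Dec P) {f : .P → A.Carrier} →
      h.⟦ ∏ᴬ.when P? f ⟧ B.≈ ∏ᴮ.when P? λ p → h.⟦ f p ⟧
    ⟦∏-when⟧ (yes _) = B.refl
    ⟦∏-when⟧ (no _)  = h.1#-homo

    ⟦∏⟧ : ∀ {n} (f : Fin n → A.Carrier) → h.⟦ ∏ᴬ.sum f ⟧ B.≈ ∏ᴮ.sum λ i → h.⟦ f i ⟧
    ⟦∏⟧ {ℕ.zero}  f = h.1#-homo
    ⟦∏⟧ {ℕ.suc n} f = B.trans (h.*-homo _ _) (B.*-congˡ (⟦∏⟧ (f ∘ suc)))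

    ⟦overBlocks⟧ : (σ : NC n) (F : (W : Subset n) → .⦃ NonZero ∣ W ∣ ⦄ → A.Carrier) →
      h.⟦ ∏ᴬ.overBlocks σ F ⟧ B.≈ ∏ᴮ.overBlocks σ λ W → h.⟦ F W ⟧
    ⟦overBlocks⟧ σ F = B.trans (⟦∏⟧ λ i → ∏ᴬ.when (leader? σ i) (value i))
      (∏ᴮ.sum-cong λ i → ⟦∏-when⟧ (leader? σ i) {value i})
      where
      value : ∀ i → .(Leader σ i) → A.Carrier
      value i _ = F (block σ i) ⦃ ∈⇒nonZero (own σ i) ⦄

  -- Characters and multiplicative functions as determined by their values at `X π` and `(π , 𝟙)`.

  X-𝟙 : .⦃ _ : NonZero n ⦄ → {π : NC n} → π ≡ 𝟙 → X K π ≡ 𝒯.1#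
  X-𝟙 {π = π} e with π ≟ 𝟙
  ... | yes _  = ≡.refl
  ... | no π≢𝟙 = contradiction e π≢𝟙

  -- Every variable is `X π` for its own partition `π`; the rest is induction on polynomial
  -- expressions.
  character-ext : {χ χ′ : Character K} →
    (∀ {n} → .⦃ _ : NonZero n ⦄ → (π : NC n) → ⟦ χ ⟧ (X K π) K.≈ ⟦ χ′ ⟧ (X K π)) → χ 𝕏.≈ χ′
  character-ext {χ} {χ′} e = go
    where
    module χ = Hom χ
    module χ′ = Hom χ′

    variable-ext : ∀ v → χ.⟦ var v ⟧ K.≈ χ′.⟦ var v ⟧
    -- Abstracting `e π` along with the decision reduces `X K π` in its type to a variable; as
    -- `proper` is irrelevant, it is the given one.
    variable-ext (record { partition = π ; proper = π≢𝟙 }) with π ≟ 𝟙 | e π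
    ... | yes π≡𝟙 | _  = contradiction-irr π≢𝟙 λ π≢𝟙 → π≢𝟙 π≡𝟙
    ... | no _    | e′ = e′

    go : χ 𝕏.≈ χ′
    go (con k)  = K.trans (χ.η-homo k) (K.sym (χ′.η-homo k))
    go (var v)  = variable-ext v
    go (p :+ q) = K.trans (χ.+-homo p q) (K.trans (K.+-cong (go p) (go q)) (K.sym (χ′.+-homo p q)))
    go (p :* q) = K.trans (χ.*-homo p q) (K.trans (K.*-cong (go p) (go q)) (K.sym (χ′.*-homo p q)))
    go (:- p)   = K.trans (χ.-‿homo p) (K.trans (K.-‿cong (go p)) (K.sym (χ′.-‿homo p)))

  -- Being a relation, it covers both passages, from `g` to a character and back. Congruence, the
  -- homomorphism law and surjectivity all become cases of `represents-unique`.
  Represents : Character K → Multiplicative K → Set ℓ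
  Represents χ g = ∀ (n : ℕ) → .⦃ _ : NonZero n ⦄ → (π : NC n) →
    ⟦ χ ⟧ (X K π) K.≈ fun g π 𝟙 (≼-𝟙 π)

  character : Multiplicative K → Character K
  character g = extend K (base K) λ where
    (record { size≢0 = n≢0 ; partition = π }) → fun g ⦃ n≢0 ⦄ π 𝟙 (≼-𝟙 π)

  character-represents : ∀ g → Represents (character g) g
  character-represents g n π with π ≟ 𝟙
  -- Here the convention that `X` at `𝟙` is the unit meets the condition that `g` is 1 on the
  -- diagonal.
  ... | yes ≡.refl = K.sym (diagonal g 𝟙)
  ... | no _       = K.refl

  represents-unique : ∀ {χ χ′ g} → Represents χ g → Represents χ′ g → χ 𝕏.≈ χ′
  represents-unique {χ} {χ′} r r′ =
    character-ext {χ} {χ′} λ {n} π → K.trans (r n π) (K.sym (r′ n π))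

  represents-cong : ∀ {χ g h} → g 𝒢.≈ h → Represents χ g → Represents χ h
  represents-cong g≈h r n π = K.trans (r n π) (g≈h π 𝟙 (≼-𝟙 π))

  -- `factor` writes every value as a product of values at pairs `(π ↾ W , 𝟙)`.
  multiplicative-ext : ∀ {g h} →
    (∀ {n} → .⦃ _ : NonZero n ⦄ → (π : NC n) → fun g π 𝟙 (≼-𝟙 π) K.≈ fun h π 𝟙 (≼-𝟙 π)) →
    g 𝒢.≈ h
  multiplicative-ext {g} {h} e π σ π≼σ = K.trans (factor g π σ π≼σ) (K.trans
    (overBlocks-cong K.*-commutativeMonoid σ
      (λ W → fun g (π ↾ W) 𝟙 (≼-𝟙 (π ↾ W))) (λ W → fun h (π ↾ W) 𝟙 (≼-𝟙 (π ↾ W)))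
      λ i → e ⦃ ∈⇒nonZero (own σ i) ⦄ (π ↾ block σ i))
    (K.sym (factor h π σ π≼σ)))

  -- Convolution of characters against convolution of functions.

  module _ (χ₁ χ₂ : Character K) (f g : Multiplicative K)
    (r₁ : Represents χ₁ f) (r₂ : Represents χ₂ g) where

    private
      χ₁⊗χ₂ : Hom K (_⊗ᵃ_ K (𝒯 K) (𝒯 K)) (base K)
      χ₁⊗χ₂ = _∘ʰ_ K (K⊗K→K K) (_⊗ʰ_ K χ₁ χ₂)

      open SetoidReasoning K.setoid

    -- The sums agree term by term: `χ₁` sends the product of the `X (π ↾ W)` to the product that
    -- `factor` identifies with `f` at `(π , σ)`, and `χ₂` gives `g` at `(σ , 𝟙)`.
    ⟦ΔX⟧ : .⦃ _ : NonZero n ⦄ → (π : NC n) →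
      ⟦ χ₁⊗χ₂ ⟧ (ΔX K π) K.≈ fun (f 𝒢.∙ g) π 𝟙 (≼-𝟙 π)
    ⟦ΔX⟧ {n} π = K.trans (⟦⨁⟧ χ₁⊗χ₂ (allNC n) _) (∑.⨁-cong (allNC n) λ σ →
      K.trans (⟦∑-when⟧ χ₁⊗χ₂ (π ≼? σ)) (∑.when-cong (π ≼? σ) λ π≼σ → begin
        ⟦ χ₁ ⟧ (BigOperators.overBlocks 𝒯.*-commutativeMonoid σ λ W → X K (π ↾ W)) K.* ⟦ χ₂ ⟧ (X K σ)
          ≈⟨ K.*-cong (⟦overBlocks⟧ χ₁ σ λ W → X K (π ↾ W)) (r₂ n σ) ⟩
        ∏.overBlocks σ (λ W → ⟦ χ₁ ⟧ (X K (π ↾ W))) K.* fun g σ 𝟙 (≼-𝟙 σ)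
          ≈⟨ K.*-congʳ (overBlocks-cong K.*-commutativeMonoid σ
               (λ W → ⟦ χ₁ ⟧ (X K (π ↾ W))) (λ W → fun f (π ↾ W) 𝟙 (≼-𝟙 (π ↾ W))) λ i →
               r₁ _ ⦃ ∈⇒nonZero (own σ i) ⦄ (π ↾ block σ i)) ⟩
        ∏.overBlocks σ (λ W → fun f (π ↾ W) 𝟙 (≼-𝟙 (π ↾ W))) K.* fun g σ 𝟙 (≼-𝟙 σ)
          ≈⟨ K.*-congʳ (factor f π σ π≼σ) ⟨
        fun f π σ π≼σ K.* fun g σ 𝟙 (≼-𝟙 σ)
          -- The convolution also tests `σ ≼ 𝟙`, which always holds.
          ≈⟨ ∑.when-yes (σ ≼? 𝟙) (≼-𝟙 σ) ⟨
        ∑.when (σ ≼? 𝟙) (λ σ≼𝟙 → fun f π σ π≼σ K.* fun g σ 𝟙 σ≼𝟙) ∎))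

    ∙-represents : Represents (χ₁ 𝕏.∙ χ₂) (f 𝒢.∙ g)
    ∙-represents n π with π ≟ 𝟙
    -- `X` at `𝟙` is no variable, so `Δ` does not unfold to `ΔX` there; unitality settles this case.
    ... | yes ≡.refl = K.trans (1#-homo (χ₁ 𝕏.∙ χ₂)) (K.sym (diagonal (f 𝒢.∙ g) 𝟙))
    ... | no _       = ⟦ΔX⟧ π

  -- The inverse of `g ↦ χ_g`: the value at `(π , 𝟙)` has to be `χ` of `X π`, and `factor` dictates
  -- all others.
  multiplicative : Character K → Multiplicative K
  multiplicative χ = record
    { fun      = λ π σ _ → ∏.overBlocks σ λ W → top (π ↾ W)
    ; diagonal = λ π → ∏.sum-ε _ λ i → K.trans
        (∏.when-cong (leader? π i)
          {λ _ → top ⦃ ∈⇒nonZero (own π i) ⦄ (π ↾ block π i)} {λ _ → K.1#} λ _ → K.trans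
          (K.reflexive (≡.cong ⟦ χ ⟧ (X-𝟙 ⦃ ∈⇒nonZero (own π i) ⦄ (↾-self π i))))
          (1#-homo χ))
        (∏.when-ε (leader? π i))
    -- Each value at `𝟙` on the right is itself a product over the single block of `𝟙`, which
    -- `overBlocks-𝟙` collapses.
    ; factor   = λ π σ _ → overBlocks-cong K.*-commutativeMonoid σ
        (λ W → top (π ↾ W)) (λ W → ∏.overBlocks 𝟙 λ V → top (π ↾ W ↾ V)) λ i →
        K.sym (overBlocks-𝟙 K.*-commutativeMonoid top ⦃ ∈⇒nonZero (own σ i) ⦄ (π ↾ block σ i))
    }
    where
    top : ∀ {m} → .⦃ NonZero m ⦄ → NC m → K.Carrier
    top τ = ⟦ χ ⟧ (X K τ)

  multiplicative-represented : ∀ χ → Represents χ (multiplicative χ)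
  multiplicative-represented χ n π =
    K.sym (overBlocks-𝟙 K.*-commutativeMonoid (λ τ → ⟦ χ ⟧ (X K τ)) π)

theorem12p9 : ∀ {c ℓ : Level} (K : CommutativeRing c ℓ) →
    Σ (∀ (g : Multiplicative K) →
         ∃! (RawMagma._≈_ (𝕏 K)) λ χ →
           ∀ (n : ℕ) → .⦃ _ : NonZero n ⦄ → (π : NC n) →
           CommutativeRing._≈_ K (Hom.⟦_⟧ χ (X K π)) (Multiplicative.fun g π 𝟙 (≼-𝟙 π)))
      λ exists! →
        MagmaMorphisms.IsMagmaIsomorphism (𝒢 K) (𝕏 K) (λ g → proj₁ (exists! g))
theorem12p9 K =
  (λ g → character K g , character-represents K g , λ {χ} → unique g {χ}) , record
    { isMagmaMonomorphism = record
      { isMagmaHomomorphism = record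
        { isRelHomomorphism = record { cong = λ {g} {h} g≈h →
            represents-unique K {character K g} {character K h} {h}
              (represents-cong K {character K g} {g} {h} g≈h (character-represents K g))
              (character-represents K h) }
        -- Both characters represent `f ∙ g`, so uniqueness identifies them.
        ; homo = λ f g → unique (RawMagma._∙_ (𝒢 K) f g)
            {RawMagma._∙_ (𝕏 K) (character K f) (character K g)}
            (∙-represents K (character K f) (character K g) f g
              (character-represents K f) (character-represents K g))
        }
      ; injective = λ {g} {h} χ≈χ′ → multiplicative-ext K {g} {h} λ {n} π →
          K.trans (K.sym (character-represents K g n π))
          (K.trans (χ≈χ′ (X K π)) (character-represents K h n π))
      }
    -- Surjectivity asks that every `g` equal to the chosen preimage be sent to `χ`, hence the
    -- transport along `g≈`.
    ; surjective = λ χ → multiplicative K χ , λ {g} g≈ →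
        represents-unique K {character K g} {χ} {multiplicative K χ}
          (represents-cong K {character K g} {g} {multiplicative K χ} g≈ (character-represents K g))
          (multiplicative-represented K χ)
    }
  where
  module K = CommutativeRing K

  unique : ∀ g {χ} → Represents K χ g → RawMagma._≈_ (𝕏 K) (character K g) χ
  unique g {χ} = represents-unique K {character K g} {χ} {g} (character-represents K g)
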